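{- Unless the Strong Exponential Time Hypothesis (SETH) fails, every algorithm that decides CIS has run time $\Omega(\delta_2^n)$, where $n$ is the number of vertices of the input graph system and $\delta_2=\sqrt{2}$.
   Context: A graph system is a tuple $\mathcal{G}=(G_0,G_1,\ldots,G_m)$ with $m\ge 1$, where all $G_i$ are graphs over the same finite vertex set $V$, $G_0$ is an undirected graph without self-loops, and $G_1,\ldots,G_m$ are directed graphs that may contain self-loops. Let $E_i$ be the edge set of $G_i$. For $\Gamma\subseteq V$ and $1\le i\le m$, a vertex $u\in\Gamma$ is $G_i$-good in $\Gamma$ if there is $v\in\Gamma$ (possibly $v=u$) with $(u,v)\in E_i$; it is good in $\Gamma$ if it is $G_i$-good in $\Gamma$ for every $1\le i\le m$. A good independent set (GIS) is a non-empty set $\Gamma\subseteq V$ that is independent in $G_0$ and all of whose vertices are good in $\Gamma$. CIS (Conditional Independent Set) is the problem: given a graph system $\mathcal{G}$, decide whether it has a GIS. For an integer $k\ge 3$, let $c_k$ be the infimum of the real numbers $\varepsilon$ such that there is a (deterministic or randomized) algorithm deciding $k$-SAT in time $O(\varepsilon^N)$, where $N$ is the number of Boolean variables. SETH states that $\lim_{k\to\infty}c_k=2$. -}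

module Defs where

import Algebra.Definitions.RawSemiring
open import Data.Bool.Base using (Bool; true; false; if_then_else_)
open import Data.Bool.Properties using (_≟_)
open import Data.Empty using (⊥)
open import Data.Fin.Base using (Fin; toℕ)
open import Data.Fin.Subset using (Subset; _∈_; Nonempty)
open import Data.Integer.Base using (+_)
open import Data.List.Base using (List; []; _∷_; _++_; length; map; tabulate)
open import Data.List.Relation.Unary.All using (All)
open import Data.List.Relation.Unary.Any using (Any)
open import Data.List.Relation.Unary.Unique.Propositional using (Unique)
open import Data.Nat as ℕ using (ℕ; zero; suc)
open import Data.Product.Base using (Σ; Σ-syntax; ∃; ∃-syntax; _×_; _,_; proj₁; proj₂)
open import Data.Rational.Base
  using (ℚ; 0ℚ; 1ℚ; ½; _/_; _+_; _-_; _*_; _≤_; _<_; +-*-rawSemiring)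
open import Data.Sum.Base using (_⊎_)
open import Data.Unit.Base using (⊤)
open import Relation.Binary.PropositionalEquality using (_≡_)
open import Relation.Nullary using (¬_)
open import Relation.Nullary.Decidable using (⌊_⌋)

open Algebra.Definitions.RawSemiring +-*-rawSemiring public using (_^_)

fromℕ : ℕ → ℚ
fromℕ n = + n / 1

2ℚ : ℚ
2ℚ = fromℕ 2

-- (Extended) real numbers as two-sided cuts: q ∈ lower means q < x, and
-- q ∈ upper means x < q.  `infimum` of the empty set is +∞.

record Cut : Set₁ where
  field
    lower : ℚ → Set
    upper : ℚ → Set

open Cut public

√2 : Cut
√2 .lower q = q < 0ℚ ⊎ q * q < 2ℚ
√2 .upper q = 0ℚ < q × 2ℚ < q * q

infimum : (ℚ → Set) → Cut
infimum S .lower q = ∃[ r ] (q < r × (∀ ε → S ε → r ≤ ε))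
infimum S .upper q = ∃[ ε ] (S ε × ε < q)

-- For every η > 0, eventually ℓ - η < a k < ℓ + η.

_ConvergesTo_ : (ℕ → Cut) → ℚ → Set
a ConvergesTo ℓ =
  ∀ η → 0ℚ < η → ∃[ K ] (∀ k → K ℕ.≤ k →
    lower (a k) (ℓ - η) × upper (a k) (ℓ + η))

-- The model of computation: WHILE programs over binary trees (a pointer
-- machine).  Every instruction manipulates a bounded number of pointers and
-- costs one time step; `flip` stores a fair random bit.  Deterministic
-- algorithms are the programs without `flip`.

data Tree : Set where
  nil  : Tree
  cons : Tree → Tree → Tree

Var : Set
Var = ℕ

data Instr : Set where
  _≔nil       : Var → Instr
  _≔_         : Var → Var → Instr
  _≔cons_,_   : Var → Var → Var → Instr
  _≔hd_       : Var → Var → Instr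
  _≔tl_       : Var → Var → Instr
  _≔flip      : Var → Instr
  branch_,_,_ : Var → List Instr → List Instr → Instr
  while_,_    : Var → List Instr → Instr

Program : Set
Program = List Instr

Store : Set
Store = Var → Tree

_[_↦_] : Store → Var → Tree → Store
(σ [ x ↦ t ]) y = if ⌊ y ℕ.≟ x ⌋ then t else σ y

hd tl : Tree → Tree
hd nil        = nil
hd (cons t _) = t
tl nil        = nil
tl (cons _ t) = t

isTrue : Tree → Bool
isTrue nil        = false
isTrue (cons _ _) = true

bit : Bool → Tree
bit false = nil
bit true  = cons nil nil

-- The instructions still to be executed, and the store.

Config : Set
Config = List Instr × Store

data Outcome : Set where
  halt : Bool → Outcome
  next : Config → Outcome
  toss : Config → Config → Outcome

-- The answer of a halted program is read off from variable 0.

step : Config → Outcome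
step ([] , σ)                    = halt (isTrue (σ 0))
step ((x ≔nil) ∷ p , σ)          = next (p , σ [ x ↦ nil ])
step ((x ≔ y) ∷ p , σ)           = next (p , σ [ x ↦ σ y ])
step ((x ≔cons y , z) ∷ p , σ)   = next (p , σ [ x ↦ cons (σ y) (σ z) ])
step ((x ≔hd y) ∷ p , σ)         = next (p , σ [ x ↦ hd (σ y) ])
step ((x ≔tl y) ∷ p , σ)         = next (p , σ [ x ↦ tl (σ y) ])
step ((x ≔flip) ∷ p , σ)         =
  toss (p , σ [ x ↦ bit false ]) (p , σ [ x ↦ bit true ])
step ((branch x , q , r) ∷ p , σ) =
  next ((if isTrue (σ x) then q else r) ++ p , σ)
step ((while x , q) ∷ p , σ)      =
  next (if isTrue (σ x) then (q ++ (while x , q) ∷ p , σ) else (p , σ))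

-- The input is in variable 0; all other variables start out as nil.

start : Program → Tree → Config
start p t = p , (λ _ → nil) [ 0 ↦ t ]

-- HaltsWithin T c: started in c, the program halts after at most T steps,
-- whatever the results of the coin flips.

haltsAfter : (Config → Set) → Outcome → Set
haltsAfter H (halt _)   = ⊤
haltsAfter H (next c)   = H c
haltsAfter H (toss c d) = H c × H d

HaltsWithin : ℕ → Config → Set
HaltsWithin zero    c = haltsAfter (λ _ → ⊥) (step c)
HaltsWithin (suc T) c = haltsAfter (HaltsWithin T) (step c)

-- Pr a T c: the probability that, started in c, the program halts after at
-- most T steps with answer a.

prAfter : Bool → (Config → ℚ) → Outcome → ℚ
prAfter a P (halt b)   = if ⌊ a ≟ b ⌋ then 1ℚ else 0ℚ
prAfter a P (next c)   = P c
prAfter a P (toss c d) = ½ * (P c + P d)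

Pr : Bool → ℕ → Config → ℚ
Pr a zero    c = prAfter a (λ _ → 0ℚ) (step c)
Pr a (suc T) c = prAfter a (Pr a T) (step c)

-- A decision problem, with the parameter in which run times are measured.

record Problem : Set₁ where
  field
    Input  : Set
    encode : Input → Tree
    size   : Input → ℕ
    Yes    : Input → Set

open Problem public

restrict : (P : Problem) → (Input P → Set) → Problem
restrict P Q = record
  { Input  = Σ (Input P) Q
  ; encode = λ x → encode P (proj₁ x)
  ; size   = λ x → size P (proj₁ x)
  ; Yes    = λ x → Yes P (proj₁ x)
  }

-- Two-sided bounded error; a deterministic program is correct with
-- probability 1 as soon as it is correct with probability at least 2/3.

Decides : Program → Problem → Set
Decides p P = ∀ (x : Input P) → let c = start p (encode P x) in
  ∃[ T ] (HaltsWithin T c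
        × (Yes P x → + 2 / 3 ≤ Pr true T c)
        × (¬ Yes P x → + 2 / 3 ≤ Pr false T c))

-- The worst-case run time over inputs of size n is O(ε ^ n).

RunTimeO : Program → Problem → ℚ → Set
RunTimeO p P ε =
  ∃[ C ] (∀ (x : Input P) →
    ∃[ T ] (HaltsWithin T (start p (encode P x)) × fromℕ T ≤ C * ε ^ size P x))

-- The worst-case run time over inputs of size n is Ω(β ^ n) for the
-- non-negative real β.  The inequality c · β ^ n ≤ T between reals is
-- expressed as c · q ^ n ≤ T for all non-negative rationals q < β.

RunTimeΩ : Program → Problem → Cut → Set
RunTimeΩ p P β =
  ∃[ c ] (0ℚ < c × ∃[ n₀ ] (∀ n → n₀ ℕ.≤ n →
    Σ[ x ∈ Input P ] (size P x ≡ n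
      × (∀ T → HaltsWithin T (start p (encode P x)) →
         ∀ q → 0ℚ ≤ q → lower β q → c * q ^ n ≤ fromℕ T))))

encodeℕ : ℕ → Tree
encodeℕ zero    = nil
encodeℕ (suc n) = cons nil (encodeℕ n)

encodeList : List Tree → Tree
encodeList []       = nil
encodeList (t ∷ ts) = cons t (encodeList ts)

-- (true , i) is the i-th variable, (false , i) its negation.

Literal : ℕ → Set
Literal N = Bool × Fin N

Clause : ℕ → Set
Clause N = List (Literal N)

-- Clauses are not repeated, so that for fixed k the length of a formula is
-- polynomial in N and a run time can be bounded in terms of N alone.

record Formula (k : ℕ) : Set where
  field
    N        : ℕ
    clauses  : List (Clause N)
    width    : All (λ C → length C ℕ.≤ k) clauses
    distinct : Unique clauses

Satisfiable : ∀ {k} → Formula k → Set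
Satisfiable φ = let open Formula φ in
  Σ[ a ∈ (Fin N → Bool) ] All (Any (λ l → a (proj₂ l) ≡ proj₁ l)) clauses

encodeLiteral : ∀ {N} → Literal N → Tree
encodeLiteral (b , i) = cons (bit b) (encodeℕ (toℕ i))

encodeFormula : ∀ {k} → Formula k → Tree
encodeFormula φ = let open Formula φ in
  cons (encodeℕ N)
       (encodeList (map (λ C → encodeList (map encodeLiteral C)) clauses))

SAT : ℕ → Problem
SAT k = record
  { Input  = Formula k
  ; encode = encodeFormula
  ; size   = Formula.N
  ; Yes    = Satisfiable
  }

-- The infimum may be taken over rational ε because the set of admissible
-- real ε is upward closed.

c : ℕ → Cut
c k = infimum (λ ε →
  0ℚ < ε × Σ[ p ∈ Program ] (Decides p (SAT k) × RunTimeO p (SAT k) ε))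

SETH : Set
SETH = c ConvergesTo 2ℚ

Digraph : ℕ → Set
Digraph n = Fin n → Fin n → Bool

record GraphSystem : Set where
  field
    n m         : ℕ
    m≥1         : 1 ℕ.≤ m
    G₀          : Digraph n
    symmetric   : ∀ u v → G₀ u v ≡ G₀ v u
    irreflexive : ∀ u → G₀ u u ≡ false
    G           : Fin m → Digraph n

module _ (𝒢 : GraphSystem) where
  open GraphSystem 𝒢

  GoodFor : Fin m → Subset n → Fin n → Set
  GoodFor i Γ u = ∃[ v ] (v ∈ Γ × G i u v ≡ true)

  Good : Subset n → Fin n → Set
  Good Γ u = ∀ i → GoodFor i Γ u

  Independent : Subset n → Set
  Independent Γ = ∀ u v → u ∈ Γ → v ∈ Γ → G₀ u v ≡ false

  IsGIS : Subset n → Set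
  IsGIS Γ = Nonempty Γ × Independent Γ × (∀ u → u ∈ Γ → Good Γ u)

encodeDigraph : ∀ {n} → Digraph n → Tree
encodeDigraph E =
  encodeList (tabulate λ u → encodeList (tabulate λ v → bit (E u v)))

-- The list of the m + 1 adjacency matrices.

encodeSystem : GraphSystem → Tree
encodeSystem 𝒢 = let open GraphSystem 𝒢 in
  encodeList (encodeDigraph G₀ ∷ tabulate (λ i → encodeDigraph (G i)))

CIS : Problem
CIS = record
  { Input  = GraphSystem
  ; encode = encodeSystem
  ; size   = GraphSystem.n
  ; Yes    = λ 𝒢 → ∃ (IsGIS 𝒢)
  }

-- The number m of digraphs is unbounded in terms of n, so the run time of
-- any program that reads its input is unbounded in terms of n as well.  In
-- CIS≤ d only systems with m ≤ n ^ d are considered.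

CIS≤ : ℕ → Problem
CIS≤ d = restrict CIS (λ 𝒢 → let open GraphSystem 𝒢 in m ℕ.≤ n ℕ.^ d)

-- For every δ < β some polynomial bound on the number of digraphs leaves a
-- problem that p does not solve in time O(δ ^ n).

NotBelow : Program → Cut → Set
NotBelow p β =
  ∀ δ → 0ℚ < δ → lower β δ → ∃[ d ] ¬ RunTimeO p (CIS≤ d) δ

{-# OPTIONS --safe #-}

-- Without a bound on the number m of digraphs the lower bound is information-theoretic: a program
-- that halts within T < 2^n steps cannot tell 2^n + 1 complete digraphs from the same list with an
-- edgeless last digraph, and only the first system has a good independent set.
--
-- With m polynomially bounded in n, k-SAT on N variables is reduced to CIS on n = 2 (N + 1)
-- vertices, the literals of the variables and of one dummy variable.  G₀ joins each literal to its
-- negation, and there is one digraph per clause C, with an edge from every vertex to each literal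
-- in C, so that a vertex is good for C iff the set contains a literal of C.  A good independent set
-- is then a consistent partial assignment that satisfies every clause.  If CIS took time O(δ^n) with
-- δ < √2, then k-SAT would take time poly(N) + O(δ^(2N)) = O(ε^N) for ε = 1 + δ²/2 < 2 and all k,
-- contradicting SETH.  The reduction is written in a small functional language whose only loop is
-- a fold over a list, and is compiled into a program with an exactly known run time.
module Submission where

open import Defs
open import Algebra.Bundles using (CommutativeRing)
import Algebra.Properties.CommutativeSemiring.Exp as Powers
open import Data.Bool.Base using (Bool; T; true; false; not; _∨_; if_then_else_)
open import Data.Bool.Properties as Bool using ()
open import Data.Empty using (⊥)
open import Data.Fin.Base as Fin using (Fin; zero; suc; toℕ; fromℕ<)
open import Data.Fin.Patterns using (0F; 1F; 2F; 3F)
open import Data.Fin.Properties as Fin using ()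
open import Data.Fin.Subset as Subset using (Subset)
open import Data.Fin.Subset.Properties using (∈⊤) renaming (_∈?_ to _∈ₛ?_)
open import Data.Integer.Base as ℤ using ()
open import Data.Integer.Properties as ℤ using ()
open import Data.List.Base
  using (List; []; _∷_; _++_; map; length; lookup; tabulate; reverse; _ʳ++_;
         cartesianProductWith; cartesianProduct; allFin)
open import Data.List.Membership.Propositional using (_∈_; find; lose)
open import Data.List.Membership.Propositional.Properties
  using (∈-lookup; ∈-map⁺; ∈-map⁻; ∈-allFin; ∈-cartesianProductWith⁺; ∈-cartesianProduct⁺)
import Data.List.Membership.DecPropositional as DecMembership
open import Data.List.Properties
  using (++-assoc; length-++; length-map; length-reverse; length-tabulate; map-cong; map-tabulate;
         map-∘; reverse-map; tabulate-cong; tabulate-lookup)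
open import Data.List.Relation.Unary.All as All using (All; []; _∷_)
open import Data.List.Relation.Unary.All.Properties as All using ()
open import Data.List.Relation.Unary.AllPairs using ([]; _∷_)
open import Data.List.Relation.Unary.Any as Any using (Any; here; there; any?)
open import Data.List.Relation.Unary.Any.Properties as Any using (lookup-index)
open import Data.List.Relation.Unary.Unique.Propositional using (Unique)
open import Data.Nat as ℕ using (ℕ; zero; suc; _≤_; _<_; _<ᵇ_; z≤n; s≤s; _+_; _*_; _⊔_)
open import Data.Nat.Properties as ℕ
open import Data.Nat.Tactic.RingSolver using (solve-∀)
open import Data.Product.Base using (∃; _×_; _,_; proj₁; proj₂; map₂)
open import Data.Product.Properties using (≡-dec)
open import Data.Rational.Base as ℚ using (ℚ; mkℚ; 0ℚ; 1ℚ; ½; toℚᵘ; positive; nonNegative)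
open import Data.Rational.Properties as ℚ using ()
open import Data.Rational.Solver using (module +-*-Solver)
open import Data.Rational.Unnormalised.Base as ℚᵘ using (mkℚᵘ; *≡*; *≤*)
open import Data.Rational.Unnormalised.Properties as ℚᵘ using ()
open import Data.Sum.Base using (_⊎_; inj₁; inj₂)
open import Data.Unit.Base using (⊤; tt)
open import Data.Vec.Base as Vec using (Vec; []; _∷_)
open import Data.Vec.Properties using ([]=⇒lookup; lookup⇒[]=; lookup∘tabulate)
open import Function.Base using (_∘_)
open import Function.Bundles using (mk⇔)
open import Relation.Binary.Definitions using (DecidableEquality)
open import Relation.Binary.PropositionalEquality
open import Relation.Nullary using (¬_; Dec; yes; no; contradiction; does)
open import Relation.Nullary.Decidable using (dec-true; dec-false; does-⇔; from-no; _×-dec_)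

open Powers (CommutativeRing.commutativeSemiring ℚ.+-*-commutativeRing)
  using () renaming (^-distrib-* to ^ℚ-distrib-*)

-- Natural numbers and powers among the rationals.

toℚᵘ-fromℕ : ∀ n → toℚᵘ (fromℕ n) ℚᵘ.≃ mkℚᵘ (ℤ.+ n) 0
toℚᵘ-fromℕ n = ℚ.toℚᵘ-fromℚᵘ (mkℚᵘ (ℤ.+ n) 0)

fromℕ-mono-≤ : ∀ {m n} → m ℕ.≤ n → fromℕ m ℚ.≤ fromℕ n
fromℕ-mono-≤ {m} {n} m≤n = ℚ.toℚᵘ-cancel-≤ (begin
  toℚᵘ (fromℕ m)  ≃⟨ toℚᵘ-fromℕ m ⟩
  mkℚᵘ (ℤ.+ m) 0  ≤⟨ *≤* (ℤ.*-monoʳ-≤-nonNeg (ℤ.+ 1) (ℤ.+≤+ m≤n)) ⟩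
  mkℚᵘ (ℤ.+ n) 0  ≃⟨ toℚᵘ-fromℕ n ⟨
  toℚᵘ (fromℕ n)  ∎)
  where open ℚᵘ.≤-Reasoning

fromℕ-+ : ∀ m n → fromℕ (m + n) ≡ fromℕ m ℚ.+ fromℕ n
fromℕ-+ m n = ℚ.toℚᵘ-injective (begin
  toℚᵘ (fromℕ (m + n))                ≈⟨ toℚᵘ-fromℕ (m + n) ⟩
  mkℚᵘ (ℤ.+ (m + n)) 0                ≈⟨ *≡* (cong (λ i → i ℤ.* ℤ.+ 1)
    (cong₂ ℤ._+_ (sym (ℤ.*-identityʳ (ℤ.+ m))) (sym (ℤ.*-identityʳ (ℤ.+ n))))) ⟩
  mkℚᵘ (ℤ.+ m) 0 ℚᵘ.+ mkℚᵘ (ℤ.+ n) 0  ≈⟨ ℚᵘ.+-cong (toℚᵘ-fromℕ m) (toℚᵘ-fromℕ n) ⟨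
  toℚᵘ (fromℕ m) ℚᵘ.+ toℚᵘ (fromℕ n)  ≈⟨ ℚ.toℚᵘ-homo-+ (fromℕ m) (fromℕ n) ⟨
  toℚᵘ (fromℕ m ℚ.+ fromℕ n)          ∎)
  where open ℚᵘ.≃-Reasoning

fromℕ-* : ∀ m n → fromℕ (m * n) ≡ fromℕ m ℚ.* fromℕ n
fromℕ-* m n = ℚ.toℚᵘ-injective (begin
  toℚᵘ (fromℕ (m * n))                ≈⟨ toℚᵘ-fromℕ (m * n) ⟩
  mkℚᵘ (ℤ.+ (m * n)) 0                ≈⟨ *≡* (cong (λ i → i ℤ.* ℤ.+ 1) (ℤ.pos-* m n)) ⟩
  mkℚᵘ (ℤ.+ m) 0 ℚᵘ.* mkℚᵘ (ℤ.+ n) 0  ≈⟨ ℚᵘ.*-cong (toℚᵘ-fromℕ m) (toℚᵘ-fromℕ n) ⟨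
  toℚᵘ (fromℕ m) ℚᵘ.* toℚᵘ (fromℕ n)  ≈⟨ ℚ.toℚᵘ-homo-* (fromℕ m) (fromℕ n) ⟨
  toℚᵘ (fromℕ m ℚ.* fromℕ n)          ∎)
  where open ℚᵘ.≃-Reasoning

fromℕ-^ : ∀ m n → fromℕ (m ℕ.^ n) ≡ fromℕ m ^ n
fromℕ-^ m zero    = refl
fromℕ-^ m (suc n) = trans (fromℕ-* m (m ℕ.^ n)) (cong (fromℕ m ℚ.*_) (fromℕ-^ m n))

*ℚ-mono-≤ : ∀ {p q r s} → 0ℚ ℚ.≤ r → 0ℚ ℚ.≤ q → p ℚ.≤ q → r ℚ.≤ s → p ℚ.* r ℚ.≤ q ℚ.* s
*ℚ-mono-≤ {p} {q} {r} {s} 0≤r 0≤q p≤q r≤s = ℚ.≤-trans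
  (ℚ.*-monoʳ-≤-nonNeg r {{nonNegative 0≤r}} p≤q)
  (ℚ.*-monoˡ-≤-nonNeg q {{nonNegative 0≤q}} r≤s)

*ℚ-nonNeg : ∀ {p q} → 0ℚ ℚ.≤ p → 0ℚ ℚ.≤ q → 0ℚ ℚ.≤ p ℚ.* q
*ℚ-nonNeg {p} {q} 0≤p 0≤q = subst (ℚ._≤ p ℚ.* q) (ℚ.*-zeroˡ q)
  (ℚ.*-monoʳ-≤-nonNeg q {{nonNegative 0≤q}} 0≤p)

^-nonNeg : ∀ {p} n → 0ℚ ℚ.≤ p → 0ℚ ℚ.≤ p ^ n
^-nonNeg zero    0≤p = fromℕ-mono-≤ {0} {1} z≤n
^-nonNeg (suc n) 0≤p = *ℚ-nonNeg 0≤p (^-nonNeg n 0≤p)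

^-mono-≤ : ∀ {p q} n → 0ℚ ℚ.≤ p → p ℚ.≤ q → p ^ n ℚ.≤ q ^ n
^-mono-≤ zero    0≤p p≤q = ℚ.≤-refl
^-mono-≤ (suc n) 0≤p p≤q =
  *ℚ-mono-≤ (^-nonNeg n 0≤p) (ℚ.≤-trans 0≤p p≤q) p≤q (^-mono-≤ n 0≤p p≤q)

^-double : ∀ p n → p ^ (n + n) ≡ (p ℚ.* p) ^ n
^-double p zero    = refl
^-double p (suc n) = begin
  p ℚ.* p ^ (n + suc n)      ≡⟨ cong (λ m → p ℚ.* p ^ m) (+-suc n n) ⟩
  p ℚ.* (p ℚ.* p ^ (n + n))  ≡⟨ ℚ.*-assoc p p _ ⟨
  p ℚ.* p ℚ.* p ^ (n + n)    ≡⟨ cong (p ℚ.* p ℚ.*_) (^-double p n) ⟩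
  p ℚ.* p ℚ.* (p ℚ.* p) ^ n  ∎
  where open ≡-Reasoning

-- Executions of programs

-- `Decides` chooses its own time bound for each input; this carries its probabilities over to any
-- other bound within which the program halts.
Pr-unique : ∀ T U c a → HaltsWithin T c → HaltsWithin U c → Pr a T c ≡ Pr a U c
Pr-unique zero zero c a h k = refl
Pr-unique zero (suc U) c a h k with step c
... | halt _ = refl
Pr-unique (suc T) zero c a h k with step c
... | halt _ = refl
Pr-unique (suc T) (suc U) c a h k with step c
... | halt _ = refl
... | next d = Pr-unique T U d a h k
... | toss d e = cong (½ ℚ.*_) (cong₂ ℚ._+_ (Pr-unique T U d a (proj₁ h) (proj₁ k))
                                            (Pr-unique T U e a (proj₂ h) (proj₂ k)))

-- No probability is lost to runs that are cut off, because every run halts within `T`.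
Pr-total : ∀ T c → HaltsWithin T c → Pr true T c ℚ.+ Pr false T c ≡ 1ℚ
Pr-total zero c h with step c
... | halt true  = refl
... | halt false = refl
Pr-total (suc T) c h with step c
... | halt true  = refl
... | halt false = refl
... | next d = Pr-total T d h
... | toss d e = begin
  ½ ℚ.* (p ℚ.+ q) ℚ.+ ½ ℚ.* (p′ ℚ.+ q′)
    ≡⟨ solve 5 (λ h p q p′ q′ → h :* (p :+ q) :+ h :* (p′ :+ q′) := h :* ((p :+ p′) :+ (q :+ q′)))
         refl ½ p q p′ q′ ⟩
  ½ ℚ.* ((p ℚ.+ p′) ℚ.+ (q ℚ.+ q′))
    ≡⟨ cong (½ ℚ.*_) (cong₂ ℚ._+_ (Pr-total T d (proj₁ h)) (Pr-total T e (proj₂ h))) ⟩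
  ½ ℚ.* (1ℚ ℚ.+ 1ℚ)
    ≡⟨⟩
  1ℚ ∎
  where
  open ≡-Reasoning
  open +-*-Solver
  p  = Pr true T d
  q  = Pr true T e
  p′ = Pr false T d
  q′ = Pr false T e

infix 4 _≈[_]_

-- Agreement at all nodes of depth less than `d`, which is all that a program can see from the root
-- in a bounded number of steps.
_≈[_]_ : Tree → ℕ → Tree → Set
t          ≈[ zero  ] u          = ⊤
nil        ≈[ suc d ] nil        = ⊤
nil        ≈[ suc d ] cons _ _   = ⊥
cons _ _   ≈[ suc d ] nil        = ⊥
cons t₁ t₂ ≈[ suc d ] cons u₁ u₂ = t₁ ≈[ d ] u₁ × t₂ ≈[ d ] u₂

≈-refl : ∀ d t → t ≈[ d ] t
≈-refl zero    t          = tt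
≈-refl (suc d) nil        = tt
≈-refl (suc d) (cons t u) = ≈-refl d t , ≈-refl d u

≈-weaken-≤ : ∀ {d e} → d ≤ e → ∀ t u → t ≈[ e ] u → t ≈[ d ] u
≈-weaken-≤ z≤n     t           u           p       = tt
≈-weaken-≤ (s≤s l) nil         nil         p       = tt
≈-weaken-≤ (s≤s l) (cons t t′) (cons u u′) (p , q) = ≈-weaken-≤ l t u p , ≈-weaken-≤ l t′ u′ q

≈-weaken : ∀ d t u → t ≈[ suc d ] u → t ≈[ d ] u
≈-weaken d = ≈-weaken-≤ (n≤1+n d)

≈-cons : ∀ d {t t′ u u′} → t ≈[ d ] u → t′ ≈[ d ] u′ → cons t t′ ≈[ d ] cons u u′
≈-cons zero    p q = tt
≈-cons (suc d) p q = ≈-weaken d _ _ p , ≈-weaken d _ _ q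

≈-hd : ∀ d t u → t ≈[ suc d ] u → hd t ≈[ d ] hd u
≈-hd d nil        nil        p       = ≈-refl d nil
≈-hd d (cons _ _) (cons _ _) (p , q) = p

≈-tl : ∀ d t u → t ≈[ suc d ] u → tl t ≈[ d ] tl u
≈-tl d nil        nil        p       = ≈-refl d nil
≈-tl d (cons _ _) (cons _ _) (p , q) = q

≈-isTrue : ∀ d t u → t ≈[ suc d ] u → isTrue t ≡ isTrue u
≈-isTrue d nil        nil        p = refl
≈-isTrue d (cons _ _) (cons _ _) p = refl

infix 4 _≈ˢ[_]_

_≈ˢ[_]_ : Store → ℕ → Store → Set
σ ≈ˢ[ d ] τ = ∀ x → σ x ≈[ d ] τ x

≈ˢ-update : ∀ d {σ τ} x {t u} → σ ≈ˢ[ suc d ] τ → t ≈[ d ] u → σ [ x ↦ t ] ≈ˢ[ d ] τ [ x ↦ u ]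
≈ˢ-update d x p q y with y ℕ.≟ x
... | yes _ = q
... | no  _ = ≈-weaken d _ _ (p y)

-- A step inspects the store to depth one and copies pointers, so it costs one level of agreement.
≈-simulation : ∀ T p {σ τ} → σ ≈ˢ[ suc T ] τ →
  (HaltsWithin T (p , σ) → HaltsWithin T (p , τ)) × (∀ a → Pr a T (p , σ) ≡ Pr a T (p , τ))
-- Reading the answer inspects the root of variable 0; this is the one level beyond `T` in the
-- hypothesis.
≈-simulation zero    [] e rewrite ≈-isTrue zero _ _ (e 0)    = (λ h → h) , λ a → refl
≈-simulation (suc T) [] e rewrite ≈-isTrue (suc T) _ _ (e 0) = (λ h → h) , λ a → refl
≈-simulation zero ((x ≔nil) ∷ p)           e = (λ h → h) , λ a → refl
≈-simulation zero ((x ≔ y) ∷ p)            e = (λ h → h) , λ a → refl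
≈-simulation zero ((x ≔cons y , z) ∷ p)    e = (λ h → h) , λ a → refl
≈-simulation zero ((x ≔hd y) ∷ p)          e = (λ h → h) , λ a → refl
≈-simulation zero ((x ≔tl y) ∷ p)          e = (λ h → h) , λ a → refl
≈-simulation zero ((x ≔flip) ∷ p)          e = (λ h → h) , λ a → refl
≈-simulation zero ((branch x , q , r) ∷ p) e = (λ h → h) , λ a → refl
≈-simulation zero ((while x , q) ∷ p) {σ} {τ} e = (λ h → h) , λ a → refl
≈-simulation (suc T) ((x ≔nil) ∷ p)        e = ≈-simulation T p (≈ˢ-update (suc T) x e (≈-refl (suc T) nil))
≈-simulation (suc T) ((x ≔ y) ∷ p)         e = ≈-simulation T p (≈ˢ-update (suc T) x e (≈-weaken (suc T) _ _ (e y)))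
≈-simulation (suc T) ((x ≔cons y , z) ∷ p) e = ≈-simulation T p (≈ˢ-update (suc T) x e
  (≈-cons (suc T) (≈-weaken (suc T) _ _ (e y)) (≈-weaken (suc T) _ _ (e z))))
≈-simulation (suc T) ((x ≔hd y) ∷ p)       e = ≈-simulation T p (≈ˢ-update (suc T) x e (≈-hd (suc T) _ _ (e y)))
≈-simulation (suc T) ((x ≔tl y) ∷ p)       e = ≈-simulation T p (≈ˢ-update (suc T) x e (≈-tl (suc T) _ _ (e y)))
≈-simulation (suc T) ((x ≔flip) ∷ p)       e
  with h₀ , p₀ ← ≈-simulation T p (≈ˢ-update (suc T) x e (≈-refl (suc T) (bit false)))
     | h₁ , p₁ ← ≈-simulation T p (≈ˢ-update (suc T) x e (≈-refl (suc T) (bit true)))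
  = (λ (k₀ , k₁) → h₀ k₀ , h₁ k₁) , λ a → cong (½ ℚ.*_) (cong₂ ℚ._+_ (p₀ a) (p₁ a))
≈-simulation (suc T) ((branch x , q , r) ∷ p) {σ} {τ} e
  with isTrue (σ x) | isTrue (τ x) | ≈-isTrue (suc T) _ _ (e x)
... | b | .b | refl = ≈-simulation T _ (λ y → ≈-weaken (suc T) _ _ (e y))
≈-simulation (suc T) ((while x , q) ∷ p) {σ} {τ} e
  with isTrue (σ x) | isTrue (τ x) | ≈-isTrue (suc T) _ _ (e x)
... | true  | .true  | refl = ≈-simulation T _ (λ y → ≈-weaken (suc T) _ _ (e y))
... | false | .false | refl = ≈-simulation T _ (λ y → ≈-weaken (suc T) _ _ (e y))

≗⇒≈ˢ : ∀ d {σ τ} → σ ≗ τ → σ ≈ˢ[ d ] τ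
≗⇒≈ˢ d {σ} e x = subst (σ x ≈[ d ]_) (e x) (≈-refl d (σ x))

-- Only `next` steps count, so the run involves no coin flips and has length exactly `t`; halting
-- and probabilities pass along it up to this shift in time.
data Reach : ℕ → Config → Config → Set where
  []  : ∀ {c} → Reach zero c c
  _∷_ : ∀ {t c d e} → step c ≡ next d → Reach t d e → Reach (suc t) c e

Reach-++ : ∀ {s t c d e} → Reach s c d → Reach t d e → Reach (s + t) c e
Reach-++ []       rs = rs
Reach-++ (e ∷ qs) rs = e ∷ Reach-++ qs rs

Reach-halts : ∀ {t T c d} → Reach t c d → HaltsWithin T d → HaltsWithin (t + T) c
Reach-halts []       h = h
Reach-halts (e ∷ rs) h rewrite e = Reach-halts rs h

Reach-Pr : ∀ {t T c d} a → Reach t c d → Pr a (t + T) c ≡ Pr a T d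
Reach-Pr a []       = refl
Reach-Pr a (e ∷ rs) rewrite e = Reach-Pr a rs

-- Quantifying over the code that follows lets runs of consecutive pieces compose, and lets a loop
-- body be followed by its own loop.
Runs : ℕ → Program → Store → Store → Set
Runs t p σ τ = ∀ rest → Reach t (p ++ rest , σ) (rest , τ)

Runs-++ : ∀ {s t p q σ τ υ} → Runs s p σ τ → Runs t q τ υ → Runs (s + t) (p ++ q) σ υ
Runs-++ {p = p} {q} f g rest rewrite ++-assoc p q rest = Reach-++ (f (q ++ rest)) (g rest)

Runs-instr : ∀ {i σ τ} → (∀ rest → step (i ∷ rest , σ) ≡ next (rest , τ)) → Runs 1 (i ∷ []) σ τ
Runs-instr e rest = e rest ∷ []

-- Systems with more digraphs than a program can read

⅔ : ℚ
⅔ = ℤ.+ 2 ℚ./ 3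

-- If `y` were a no-instance, the program would accept `x` and, being unable to tell `x` from `y`
-- within `T` steps, also reject it, each with probability at least 2/3, for a total of 4/3. The
-- conclusion is doubly negated because `Decides` says something about `y` only once `Yes` or its
-- negation is assumed.
Decides-≈ : ∀ {A P} → Decides A P → ∀ x y T →
  HaltsWithin T (start A (encode P x)) → encode P x ≈[ suc T ] encode P y →
  Yes P x → ¬ ¬ Yes P y
Decides-≈ {A} {P} dec x y T hx e yes-x ¬yes-y
  with Tx , kx , px , _ ← dec x | Ty , ky , _ , py ← dec y
  = from-no (⅔ ℚ.+ ⅔ ℚ.≤? 1ℚ) 4/3≤1
  where
  cx = start A (encode P x)
  cy = start A (encode P y)

  stores : proj₂ cx ≈ˢ[ suc T ] proj₂ cy
  stores zero    = e
  stores (suc _) = tt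

  hy : HaltsWithin T cy
  hy = proj₁ (≈-simulation T A stores) hx

  ⅔≤yes : ⅔ ℚ.≤ Pr true T cx
  ⅔≤yes = subst (⅔ ℚ.≤_) (Pr-unique Tx T cx true kx hx) (px yes-x)

  ⅔≤no : ⅔ ℚ.≤ Pr false T cx
  ⅔≤no = subst (⅔ ℚ.≤_)
    (trans (Pr-unique Ty T cy false ky hy) (sym (proj₂ (≈-simulation T A stores) false)))
    (py ¬yes-y)

  4/3≤1 : ⅔ ℚ.+ ⅔ ℚ.≤ 1ℚ
  4/3≤1 = subst (⅔ ℚ.+ ⅔ ℚ.≤_) (Pr-total T cx hx) (ℚ.+-mono-≤ ⅔≤yes ⅔≤no)

encodeList-tabulate-≈ : ∀ d {m} (f g : Fin m → Tree) → (∀ i → toℕ i ℕ.< d → f i ≡ g i) →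
  encodeList (tabulate f) ≈[ d ] encodeList (tabulate g)
encodeList-tabulate-≈ zero    f g f≡g = tt
encodeList-tabulate-≈ (suc d) {zero}  f g f≡g = tt
encodeList-tabulate-≈ (suc d) {suc m} f g f≡g =
  subst (f Fin.zero ≈[ d ]_) (f≡g Fin.zero (s≤s z≤n)) (≈-refl d (f Fin.zero)) ,
  encodeList-tabulate-≈ d _ _ (λ i i<d → f≡g (Fin.suc i) (s≤s i<d))

-- It is `G₀` that is edgeless, which makes every set of vertices independent; the digraphs are
-- arbitrary.
edgeless : ∀ {n m} → (Fin m → Digraph n) → 1 ≤ m → GraphSystem
edgeless {n} {m} G m≥1 = record
  { n = n; m = m; m≥1 = m≥1
  ; G₀ = λ _ _ → false; symmetric = λ _ _ → refl; irreflexive = λ _ → refl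
  ; G = G
  }

complete : ∀ n K → GraphSystem
complete n K = edgeless {n} {suc K} (λ _ _ _ → true) (s≤s z≤n)

completeBelow : ∀ n K → GraphSystem
completeBelow n K = edgeless {n} {suc K} (λ i _ _ → toℕ i <ᵇ K) (s≤s z≤n)

complete-GIS : ∀ n K → 1 ≤ n → ∃ (IsGIS (complete n K))
complete-GIS (suc n) K _ = Subset.⊤ ,
  (Fin.zero , ∈⊤) , (λ _ _ _ _ → refl) , λ _ _ _ → Fin.zero , ∈⊤ , refl

completeBelow-¬GIS : ∀ n K → ¬ ∃ (IsGIS (completeBelow n K))
completeBelow-¬GIS n K (Γ , (u , u∈Γ) , _ , good)
  -- The last of the `suc K` digraphs has index `K`, so that an edge in it would require `K < K`.
  with _ , _ , e ← good u u∈Γ (Fin.fromℕ K)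
  rewrite Fin.toℕ-fromℕ K = <-irrefl refl (<ᵇ⇒< K K (subst T (sym e) tt))

-- The matrix that differs hangs off a spine cell preceded by `K + 1` others, those of `G₀` and of
-- the first `K` digraphs.
complete-≈ : ∀ n K → encodeSystem (complete n K) ≈[ suc K ] encodeSystem (completeBelow n K)
complete-≈ n K = ≈-refl K _ , encodeList-tabulate-≈ K _ _ (λ i i<K → cong (λ b → encodeDigraph {n} (λ _ _ → b))
  (sym (T⇒≡true (<⇒<ᵇ i<K))))
  where
  T⇒≡true : ∀ {b} → T b → b ≡ true
  T⇒≡true {true} _ = refl

-- So crude a bound is enough, since the systems used below force `2 ^ n` steps.
lower-√2⇒≤2 : ∀ q → lower √2 q → q ℚ.≤ 2ℚ
lower-√2⇒≤2 q (inj₁ q<0)  = ℚ.≤-trans (ℚ.<⇒≤ q<0) (fromℕ-mono-≤ {0} {2} z≤n)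
lower-√2⇒≤2 q (inj₂ q²<2) = ℚ.≮⇒≥ λ 2<q → ℚ.<-irrefl refl (ℚ.<-≤-trans q²<2 (ℚ.≤-trans
  (fromℕ-mono-≤ {2} {4} (s≤s (s≤s z≤n)))
  (*ℚ-mono-≤ (fromℕ-mono-≤ {0} {2} z≤n) (ℚ.≤-trans (fromℕ-mono-≤ {0} {2} z≤n) (ℚ.<⇒≤ 2<q))
    (ℚ.<⇒≤ 2<q) (ℚ.<⇒≤ 2<q))))

CIS-RunTimeΩ-√2 : ∀ A → Decides A CIS → RunTimeΩ A CIS √2
-- The threshold is 1 because a system without vertices has no GIS. Taking `2 ^ n` for `K` makes the
-- list of digraphs too long to be read in fewer than `2 ^ n` steps.
CIS-RunTimeΩ-√2 A dec = 1ℚ , ℚ.positive⁻¹ 1ℚ , 1 , λ n 1≤n →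
  complete n (2 ℕ.^ n) , refl , bound n 1≤n
  where
  bound : ∀ n → 1 ≤ n → ∀ T → HaltsWithin T (start A (encodeSystem (complete n (2 ℕ.^ n)))) →
    ∀ q → 0ℚ ℚ.≤ q → lower √2 q → 1ℚ ℚ.* q ^ n ℚ.≤ fromℕ T
  bound n 1≤n T h q 0≤q q<√2 with 2 ℕ.^ n ℕ.≤? T
  ... | yes 2ⁿ≤T = begin
    1ℚ ℚ.* q ^ n     ≡⟨ ℚ.*-identityˡ (q ^ n) ⟩
    q ^ n            ≤⟨ ^-mono-≤ n 0≤q (lower-√2⇒≤2 q q<√2) ⟩
    2ℚ ^ n           ≡⟨ fromℕ-^ 2 n ⟨
    fromℕ (2 ℕ.^ n)  ≤⟨ fromℕ-mono-≤ 2ⁿ≤T ⟩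
    fromℕ T          ∎
    where open ℚ.≤-Reasoning
  ... | no 2ⁿ≰T = contradiction (completeBelow-¬GIS n (2 ℕ.^ n))
    (Decides-≈ {A} {CIS} dec (complete n (2 ℕ.^ n)) (completeBelow n (2 ℕ.^ n)) T h
      (≈-weaken-≤ (s≤s (<⇒≤ (≰⇒> 2ⁿ≰T))) _ _ (complete-≈ n (2 ℕ.^ n)))
      (complete-GIS n (2 ℕ.^ n) 1≤n))

-- Compiling a functional language with folds

-- `fold l z b` runs down the right spine of l.  In the body b, variable 0 is the part of the
-- spine that is still to be processed and variable 1 is the accumulator.
data Exp (k : ℕ) : Set where
  var  : Fin k → Exp k
  nil  : Exp k
  cons : Exp k → Exp k → Exp k
  head : Exp k → Exp k
  tail : Exp k → Exp k
  cond : Exp k → Exp k → Exp k → Exp k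
  call : Exp 2 → Exp k → Exp k → Exp k
  fold : Exp k → Exp k → Exp (2 + k) → Exp k

-- The function receives the whole remaining spine instead of its head, so that a fold over a unary
-- number can use the predecessor as a loop counter.
foldTree : (Tree → Tree → Tree) → Tree → Tree → Tree
foldTree f nil        a = a
foldTree f (cons h t) a = foldTree f t (f (cons h t) a)

-- Each round costs one loop test, the body, and the two assignments that close `loopBody`; the
-- final 1 is the failing test.
foldTime : (Tree → Tree → Tree) → (Tree → Tree → ℕ) → Tree → Tree → ℕ
foldTime f τ nil        a = 1
foldTime f τ (cons h t) a = suc (τ (cons h t) a + 2 + foldTime f τ t (f (cons h t) a))

eval : ∀ {k} → Exp k → Vec Tree k → Tree
eval (var i)      ρ = Vec.lookup ρ i
eval nil          ρ = nil
eval (cons d e)   ρ = cons (eval d ρ) (eval e ρ)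
eval (head e)     ρ = hd (eval e ρ)
eval (tail e)     ρ = tl (eval e ρ)
eval (cond b d e) ρ = if isTrue (eval b ρ) then eval d ρ else eval e ρ
eval (call f d e) ρ = eval f (eval d ρ ∷ eval e ρ ∷ [])
eval (fold l z b) ρ = foldTree (λ s a → eval b (s ∷ a ∷ ρ)) (eval l ρ) (eval z ρ)

time : ∀ {k} → Exp k → Vec Tree k → ℕ
time (var i)      ρ = 1
time nil          ρ = 1
time (cons d e)   ρ = time d ρ + (time e ρ + 1)
time (head e)     ρ = time e ρ + 1
time (tail e)     ρ = time e ρ + 1
time (cond b d e) ρ = time b ρ + suc (if isTrue (eval b ρ) then time d ρ else time e ρ)
time (call f d e) ρ = time d ρ + (time e ρ + (time f (eval d ρ ∷ eval e ρ ∷ []) + 1))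
time (fold l z b) ρ = time z ρ + (time l ρ +
  foldTime (λ s a → eval b (s ∷ a ∷ ρ)) (λ s a → time b (s ∷ a ∷ ρ)) (eval l ρ) (eval z ρ))

-- The values of the variables are in the registers r, the result is left in register n, and
-- registers from n on are used as scratch space.
compile : ∀ {k} → Vec Var k → ℕ → Exp k → Program
loopBody : ∀ {k} → Exp (2 + k) → Vec Var k → ℕ → Program

compile r n (var i)      = (n ≔ Vec.lookup r i) ∷ []
compile r n nil          = (n ≔nil) ∷ []
compile r n (cons d e)   = compile r n d ++ compile r (suc n) e ++ (n ≔cons n , suc n) ∷ []
compile r n (head e)     = compile r n e ++ (n ≔hd n) ∷ []
compile r n (tail e)     = compile r n e ++ (n ≔tl n) ∷ []
compile r n (cond b d e) = compile r n b ++ (branch n , compile r n d , compile r n e) ∷ []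
compile r n (call f d e) = compile r n d ++ compile r (suc n) e ++
  compile (n ∷ suc n ∷ []) (2 + n) f ++ (n ≔ suc (suc n)) ∷ []
compile r n (fold l z b) = compile r n z ++ compile r (suc n) l ++ (while suc n , loopBody b r n) ∷ []

loopBody b r n = compile (suc n ∷ n ∷ r) (2 + n) b ++ (n ≔ suc (suc n)) ∷ (suc n ≔tl suc n) ∷ []

-- `compile r n e` writes only to registers from `n` up to, but excluding, this one. The bound also
-- tells how many registers have to be erased afterwards.
scratchEnd : ∀ {k} → ℕ → Exp k → ℕ
scratchEnd n (var i)      = suc n
scratchEnd n nil          = suc n
scratchEnd n (cons d e)   = scratchEnd n d ⊔ scratchEnd (suc n) e
scratchEnd n (head e)     = scratchEnd n e
scratchEnd n (tail e)     = scratchEnd n e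
scratchEnd n (cond b d e) = scratchEnd n b ⊔ (scratchEnd n d ⊔ scratchEnd n e)
scratchEnd n (call f d e) = scratchEnd n d ⊔ (scratchEnd (suc n) e ⊔ scratchEnd (2 + n) f)
scratchEnd n (fold l z b) = scratchEnd n z ⊔ (scratchEnd (suc n) l ⊔ scratchEnd (2 + n) b)

n<scratchEnd : ∀ {k} n (e : Exp k) → n < scratchEnd n e
n<scratchEnd n (var i)      = ≤-refl
n<scratchEnd n nil          = ≤-refl
n<scratchEnd n (cons d e)   = ≤-trans (n<scratchEnd n d) (m≤m⊔n _ _)
n<scratchEnd n (head e)     = n<scratchEnd n e
n<scratchEnd n (tail e)     = n<scratchEnd n e
n<scratchEnd n (cond b d e) = ≤-trans (n<scratchEnd n b) (m≤m⊔n _ _)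
n<scratchEnd n (call f d e) = ≤-trans (n<scratchEnd n d) (m≤m⊔n _ _)
n<scratchEnd n (fold l z b) = ≤-trans (n<scratchEnd n z) (m≤m⊔n _ _)

-- As a frame: registers below `m` hold variables and intermediate results that are still needed,
-- those from `n` on keep their initial contents.
Outside : ℕ → ℕ → Var → Set
Outside m n x = x < m ⊎ n ≤ x

Outside-⊆ : ∀ {m n m′ n′ x} → m ≤ m′ → n′ ≤ n → Outside m n x → Outside m′ n′ x
Outside-⊆ m≤m′ n′≤n (inj₁ x<m) = inj₁ (<-≤-trans x<m m≤m′)
Outside-⊆ m≤m′ n′≤n (inj₂ n≤x) = inj₂ (≤-trans n′≤n n≤x)

Outside-≢ : ∀ {m n x y} → m ≤ y → y < n → Outside m n x → x ≢ y
Outside-≢ m≤y y<n (inj₁ x<m) refl = <-irrefl refl (<-≤-trans x<m m≤y)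
Outside-≢ m≤y y<n (inj₂ n≤x) refl = <-irrefl refl (<-≤-trans y<n n≤x)

update-≡ : ∀ σ x t → (σ [ x ↦ t ]) x ≡ t
update-≡ σ x t with x ℕ.≟ x
... | yes _  = refl
... | no x≢x = contradiction refl x≢x

update-≢ : ∀ σ {x y} t → y ≢ x → (σ [ x ↦ t ]) y ≡ σ y
update-≢ σ {x} {y} t y≢x with y ℕ.≟ x
... | yes y≡x = contradiction y≡x y≢x
... | no _    = refl

record Computes (t : ℕ) (p : Program) (σ : Store) (m n : ℕ) (v : Tree) : Set where
  constructor computes
  field
    {final} : Store
    runs    : Runs t p σ final
    frame   : ∀ x → Outside m n x → final x ≡ σ x
    result  : final m ≡ v

Holds : ∀ {k} → Store → Vec Var k → Vec Tree k → Set
Holds σ r ρ = ∀ i → σ (Vec.lookup r i) ≡ Vec.lookup ρ i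

AllBelow : ∀ {k} → ℕ → Vec Var k → Set
AllBelow n r = ∀ i → Vec.lookup r i < n

AllBelow-suc : ∀ {k n} {r : Vec Var k} → AllBelow n r → AllBelow (suc n) r
AllBelow-suc r<n i = m<n⇒m<1+n (r<n i)

while-true : ∀ {t x q σ τ} → isTrue (σ x) ≡ true → Runs t q σ τ →
  ∀ {s υ} → Runs s ((while x , q) ∷ []) τ υ → Runs (suc (t + s)) ((while x , q) ∷ []) σ υ
while-true {t} {x} {q} {σ} b r rs rest = stepTrue ∷ Reach-++ (r _) (rs rest)
  where
  stepTrue : step ((while x , q) ∷ rest , σ) ≡ next (q ++ (while x , q) ∷ rest , σ)
  stepTrue rewrite b = refl

-- Has the exact form in which `step` leaves the store after the two closing assignments of
-- `loopBody`, so that these steps hold by `refl`.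
advance : ℕ → Store → Store
advance n σ = (σ [ n ↦ σ (2 + n) ]) [ suc n ↦ tl ((σ [ n ↦ σ (2 + n) ]) (suc n)) ]

advance-frame : ∀ n σ {e} → 2 + n < e → ∀ x → Outside n e x → advance n σ x ≡ σ x
advance-frame n σ n+2<e x o = trans
  (update-≢ (σ [ n ↦ _ ]) _ (Outside-≢ (n≤1+n n) (<⇒≤ n+2<e) o))
  (update-≢ σ _ (Outside-≢ ≤-refl (<⇒≤ (<⇒≤ n+2<e)) o))

m≤n⊔m⊔o : ∀ n m o → m ≤ n ⊔ (m ⊔ o)
m≤n⊔m⊔o n m o = ≤-trans (m≤m⊔n m o) (m≤n⊔m n (m ⊔ o))

m≤n⊔o⊔m : ∀ n o m → m ≤ n ⊔ (o ⊔ m)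
m≤n⊔o⊔m n o m = ≤-trans (m≤n⊔m o m) (m≤n⊔m n (o ⊔ m))

-- A subexpression is compiled above the registers whose contents are still needed, so the frame
-- condition preserves both the variables and the results already obtained.
compile-correct : ∀ {k} (e : Exp k) r n σ ρ → AllBelow n r → Holds σ r ρ →
  Computes (time e ρ) (compile r n e) σ n (scratchEnd n e) (eval e ρ)

-- By induction on the spine `s`, with the accumulator and the store left arbitrary because every
-- round changes them.
loop-correct : ∀ {k} (b : Exp (2 + k)) r n s a σ ρ → AllBelow n r →
  σ (suc n) ≡ s → σ n ≡ a → Holds σ r ρ →
  Computes (foldTime (λ s a → eval b (s ∷ a ∷ ρ)) (λ s a → time b (s ∷ a ∷ ρ)) s a)
           ((while suc n , loopBody b r n) ∷ []) σ n (scratchEnd (2 + n) b)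
           (foldTree (λ s a → eval b (s ∷ a ∷ ρ)) s a)

compile-correct (var i) r n σ ρ r<n h = computes
  (Runs-instr (λ _ → refl))
  (λ x o → update-≢ σ _ (Outside-≢ ≤-refl ≤-refl o))
  (trans (update-≡ σ n _) (h i))
compile-correct nil r n σ ρ r<n h = computes
  (Runs-instr (λ _ → refl))
  (λ x o → update-≢ σ _ (Outside-≢ ≤-refl ≤-refl o))
  (update-≡ σ n _)
compile-correct (cons d e) r n σ ρ r<n h
  with computes {σ₁} runs₁ frame₁ res₁ ← compile-correct d r n σ ρ r<n h
  with computes {σ₂} runs₂ frame₂ res₂ ← compile-correct e r (suc n) σ₁ ρ (AllBelow-suc {r = r} r<n)
         (λ i → trans (frame₁ _ (inj₁ (r<n i))) (h i))
  = computes
  (Runs-++ runs₁ (Runs-++ runs₂ (Runs-instr (λ _ → refl))))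
  (λ x o → trans (update-≢ σ₂ _ (Outside-≢ ≤-refl (n<scratchEnd n (cons d e)) o))
    (trans (frame₂ x (Outside-⊆ (n≤1+n n) (m≤n⊔m _ _) o))
           (frame₁ x (Outside-⊆ ≤-refl (m≤m⊔n _ _) o))))
  (trans (update-≡ σ₂ n _) (cong₂ cons (trans (frame₂ n (inj₁ ≤-refl)) res₁) res₂))
compile-correct (head e) r n σ ρ r<n h
  with computes {σ₁} runs frame res ← compile-correct e r n σ ρ r<n h
  = computes
  (Runs-++ runs (Runs-instr (λ _ → refl)))
  (λ x o → trans (update-≢ σ₁ _ (Outside-≢ ≤-refl (n<scratchEnd n e) o)) (frame x o))
  (trans (update-≡ σ₁ n _) (cong hd res))
compile-correct (tail e) r n σ ρ r<n h
  with computes {σ₁} runs frame res ← compile-correct e r n σ ρ r<n h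
  = computes
  (Runs-++ runs (Runs-instr (λ _ → refl)))
  (λ x o → trans (update-≢ σ₁ _ (Outside-≢ ≤-refl (n<scratchEnd n e) o)) (frame x o))
  (trans (update-≡ σ₁ n _) (cong tl res))
compile-correct (cond b d e) r n σ ρ r<n h
  with computes {σ₁} runs₁ frame₁ res₁ ← compile-correct b r n σ ρ r<n h
  with h₁ ← (λ i → trans (frame₁ _ (inj₁ (r<n i))) (h i))
  with isTrue (eval b ρ) in b≡
... | true
  with computes {σ₂} runs₂ frame₂ res₂ ← compile-correct d r n σ₁ ρ r<n h₁
  = computes
  (Runs-++ runs₁ (λ rest → stepBranch rest ∷ runs₂ rest))
  (λ x o → trans (frame₂ x (Outside-⊆ ≤-refl (m≤n⊔m⊔o (scratchEnd n b) (scratchEnd n d) (scratchEnd n e)) o))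
                 (frame₁ x (Outside-⊆ ≤-refl (m≤m⊔n _ _) o)))
  res₂
  where
  stepBranch : ∀ rest → step ((branch n , compile r n d , compile r n e) ∷ rest , σ₁)
                      ≡ next (compile r n d ++ rest , σ₁)
  stepBranch rest rewrite res₁ | b≡ = refl
... | false
  with computes {σ₂} runs₂ frame₂ res₂ ← compile-correct e r n σ₁ ρ r<n h₁
  = computes
  (Runs-++ runs₁ (λ rest → stepBranch rest ∷ runs₂ rest))
  (λ x o → trans (frame₂ x (Outside-⊆ ≤-refl (m≤n⊔o⊔m (scratchEnd n b) (scratchEnd n d) (scratchEnd n e)) o))
                 (frame₁ x (Outside-⊆ ≤-refl (m≤m⊔n _ _) o)))
  res₂
  where
  stepBranch : ∀ rest → step ((branch n , compile r n d , compile r n e) ∷ rest , σ₁)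
                      ≡ next (compile r n e ++ rest , σ₁)
  stepBranch rest rewrite res₁ | b≡ = refl
compile-correct (call f d e) r n σ ρ r<n h
  with computes {σ₁} runs₁ frame₁ res₁ ← compile-correct d r n σ ρ r<n h
  with computes {σ₂} runs₂ frame₂ res₂ ← compile-correct e r (suc n) σ₁ ρ (AllBelow-suc {r = r} r<n)
         (λ i → trans (frame₁ _ (inj₁ (r<n i))) (h i))
  with computes {σ₃} runs₃ frame₃ res₃ ← compile-correct f (n ∷ suc n ∷ []) (2 + n) σ₂
         (eval d ρ ∷ eval e ρ ∷ [])
         (λ { zero → n≤1+n (suc n) ; (suc zero) → ≤-refl })
         (λ { zero → trans (frame₂ n (inj₁ ≤-refl)) res₁ ; (suc zero) → res₂ })
  = computes
  (Runs-++ runs₁ (Runs-++ runs₂ (Runs-++ runs₃ (Runs-instr (λ _ → refl)))))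
  (λ x o → trans (update-≢ σ₃ _ (Outside-≢ ≤-refl (n<scratchEnd n (call f d e)) o))
    (trans (frame₃ x (Outside-⊆ (m≤n+m n 2) (m≤n⊔o⊔m (scratchEnd n d) (scratchEnd (suc n) e) (scratchEnd (2 + n) f)) o))
    (trans (frame₂ x (Outside-⊆ (n≤1+n n) (m≤n⊔m⊔o (scratchEnd n d) (scratchEnd (suc n) e) (scratchEnd (2 + n) f)) o))
           (frame₁ x (Outside-⊆ ≤-refl (m≤m⊔n _ _) o)))))
  (trans (update-≡ σ₃ n _) res₃)
compile-correct (fold l z b) r n σ ρ r<n h
  with computes {σ₁} runs₁ frame₁ res₁ ← compile-correct z r n σ ρ r<n h
  with computes {σ₂} runs₂ frame₂ res₂ ← compile-correct l r (suc n) σ₁ ρ (AllBelow-suc {r = r} r<n)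
         (λ i → trans (frame₁ _ (inj₁ (r<n i))) (h i))
  with computes {σ₃} runs₃ frame₃ res₃ ← loop-correct b r n (eval l ρ) (eval z ρ) σ₂ ρ r<n res₂
         (trans (frame₂ n (inj₁ ≤-refl)) res₁)
         (λ i → trans (frame₂ _ (inj₁ (m<n⇒m<1+n (r<n i)))) (trans (frame₁ _ (inj₁ (r<n i))) (h i)))
  = computes
  (Runs-++ runs₁ (Runs-++ runs₂ runs₃))
  (λ x o → trans (frame₃ x (Outside-⊆ ≤-refl (m≤n⊔o⊔m (scratchEnd n z) (scratchEnd (suc n) l) (scratchEnd (2 + n) b)) o))
    (trans (frame₂ x (Outside-⊆ (n≤1+n n) (m≤n⊔m⊔o (scratchEnd n z) (scratchEnd (suc n) l) (scratchEnd (2 + n) b)) o))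
           (frame₁ x (Outside-⊆ ≤-refl (m≤m⊔n _ _) o))))
  res₃

loop-correct b r n nil a σ ρ r<n s≡ a≡ h = computes (Runs-instr stepFalse) (λ _ _ → refl) a≡
  where
  stepFalse : ∀ rest → step ((while suc n , loopBody b r n) ∷ rest , σ) ≡ next (rest , σ)
  stepFalse rest rewrite s≡ = refl
loop-correct b r n (cons u t) a σ ρ r<n s≡ a≡ h
  with computes {σ₁} runs₁ frame₁ res₁ ← compile-correct b (suc n ∷ n ∷ r) (2 + n) σ (cons u t ∷ a ∷ ρ)
         (λ { zero → ≤-refl ; (suc zero) → n≤1+n (suc n) ; (suc (suc i)) → m≤n⇒m≤o+n 2 (r<n i) })
         (λ { zero → s≡ ; (suc zero) → a≡ ; (suc (suc i)) → h i })
  with computes runs₂ frame₂ res₂ ← loop-correct b r n t (eval b (cons u t ∷ a ∷ ρ)) (advance n σ₁) ρ r<n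
         (trans (update-≡ (σ₁ [ n ↦ _ ]) (suc n) _)
           (cong tl (trans (update-≢ σ₁ _ 1+n≢n) (trans (frame₁ (suc n) (inj₁ ≤-refl)) s≡))))
         (trans (update-≢ (σ₁ [ n ↦ σ₁ (2 + n) ]) {suc n} {n} _ (λ e → 1+n≢n (sym e))) (trans (update-≡ σ₁ n _) res₁))
         (λ i → trans (advance-frame n σ₁ (n<scratchEnd (2 + n) b) _ (inj₁ (r<n i)))
           (trans (frame₁ _ (inj₁ (m≤n⇒m≤o+n 2 (r<n i)))) (h i)))
  = computes
  (while-true (cong isTrue s≡) (Runs-++ runs₁ (λ rest → refl ∷ refl ∷ [])) runs₂)
  (λ x o → trans (frame₂ x o) (trans (advance-frame n σ₁ (n<scratchEnd (2 + n) b) x o)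
    (frame₁ x (Outside-⊆ (m≤n+m n 2) ≤-refl o))))
  res₂

-- A program may rely on every variable but 0 being `nil` at the start, so the scratch registers are
-- erased before it takes over.
clear : ℕ → Program
clear zero    = []
clear (suc w) = (suc w ≔nil) ∷ clear w

cleared : ℕ → Store → Store
cleared zero    σ = σ
cleared (suc w) σ = cleared w (σ [ suc w ↦ nil ])

clear-runs : ∀ w σ → Runs w (clear w) σ (cleared w σ)
clear-runs zero    σ rest = []
clear-runs (suc w) σ rest = refl ∷ clear-runs w _ rest

cleared-outside : ∀ w σ x → x ≡ 0 ⊎ w < x → cleared w σ x ≡ σ x
cleared-outside zero    σ x o = refl
cleared-outside (suc w) σ x (inj₁ refl) = cleared-outside w _ x (inj₁ refl)
cleared-outside (suc w) σ x (inj₂ w<x)  = trans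
  (cleared-outside w _ x (inj₂ (<⇒≤ w<x)))
  (update-≢ σ _ λ { refl → <-irrefl refl w<x })

cleared-inside : ∀ w σ x → x < w → cleared w σ (suc x) ≡ nil
cleared-inside (suc w) σ x (s≤s x≤w) with m≤n⇒m<n∨m≡n x≤w
... | inj₁ x<w  = cleared-inside w _ x x<w
... | inj₂ refl = trans (cleared-outside w _ (suc w) (inj₂ ≤-refl)) (update-≡ σ (suc w) nil)

precompute : Exp 1 → Program → Program
precompute e A = (compile (0 ∷ []) 1 e ++ (0 ≔ 1) ∷ clear (scratchEnd 1 e)) ++ A

precomputeTime : Exp 1 → Tree → ℕ
precomputeTime e t = time e (t ∷ []) + suc (scratchEnd 1 e)

-- The store that `A` finds equals its proper starting store pointwise. That is enough: pointwise
-- equal stores agree to every depth, and `≈-simulation` transfers halting and probabilities.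
precompute-reach : ∀ e A t → ∃ λ τ →
  Reach (precomputeTime e t) (start (precompute e A) t) (A , τ) ×
  τ ≗ proj₂ (start A (eval e (t ∷ [])))
precompute-reach e A t
  with computes {σ₁} runs frame result ← compile-correct e (0 ∷ []) 1 (proj₂ (start A t)) (t ∷ [])
         (λ { zero → s≤s z≤n }) (λ { zero → refl })
  = cleared w (σ₁ [ 0 ↦ σ₁ 1 ])
  , Runs-++ runs (λ rest → refl ∷ clear-runs w (σ₁ [ 0 ↦ σ₁ 1 ]) rest) A
  , stores
  where
  w = scratchEnd 1 e
  stores : cleared w (σ₁ [ 0 ↦ σ₁ 1 ]) ≗ proj₂ (start A (eval e (t ∷ [])))
  stores zero    = trans (cleared-outside w _ 0 (inj₁ refl)) result
  stores (suc x) with x ℕ.<? w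
  ... | yes x<w = cleared-inside w _ x x<w
  ... | no x≮w  = trans (cleared-outside w _ (suc x) (inj₂ (s≤s (≮⇒≥ x≮w))))
                        (frame (suc x) (inj₂ (m≤n⇒m≤1+n (≮⇒≥ x≮w))))

module _ (e : Exp 1) (A : Program) (t : Tree) (T : ℕ) where
  private
    reach = proj₁ (proj₂ (precompute-reach e A t))
    same  = proj₂ (proj₂ (precompute-reach e A t))

  precompute-halts : HaltsWithin T (start A (eval e (t ∷ []))) →
    HaltsWithin (precomputeTime e t + T) (start (precompute e A) t)
  precompute-halts h = Reach-halts reach
    (proj₁ (≈-simulation T A (≗⇒≈ˢ (suc T) (λ x → sym (same x)))) h)

  precompute-Pr : ∀ a → Pr a (precomputeTime e t + T) (start (precompute e A) t)
                      ≡ Pr a T (start A (eval e (t ∷ [])))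
  precompute-Pr a = trans (Reach-Pr a reach) (proj₂ (≈-simulation T A (≗⇒≈ˢ (suc T) same)) a)

-- Reductions between decision problems.

record Reduction (P Q : Problem) : Set where
  field
    instanceOf : Input P → Input Q
    code       : Exp 1
    computes-instance : ∀ x → eval code (encode P x ∷ []) ≡ encode Q (instanceOf x)
    sound      : ∀ x → Yes Q (instanceOf x) → Yes P x
    adequate   : ∀ x → Yes P x → Yes Q (instanceOf x)

  reduce : Program → Program
  reduce = precompute code

  overhead : Input P → ℕ
  overhead x = precomputeTime code (encode P x)

  reduce-halts : ∀ A x T → HaltsWithin T (start A (encode Q (instanceOf x))) →
    HaltsWithin (overhead x + T) (start (reduce A) (encode P x))
  reduce-halts A x T h = precompute-halts code A (encode P x) T
    (subst (λ t → HaltsWithin T (start A t)) (sym (computes-instance x)) h)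

  reduce-decides : ∀ A → Decides A Q → Decides (reduce A) P
  reduce-decides A dec x with T , h , accept , reject ← dec (instanceOf x) =
    overhead x + T , reduce-halts A x T h ,
    (λ y → subst (_ ℚ.≤_) (sym (prob _)) (accept (adequate x y))) ,
    (λ n → subst (_ ℚ.≤_) (sym (prob _)) (reject (λ y → n (sound x y))))
    where
    prob : ∀ a → Pr a (overhead x + T) (start (reduce A) (encode P x))
               ≡ Pr a T (start A (encode Q (instanceOf x)))
    prob a = trans (precompute-Pr code A (encode P x) T a)
                   (cong (λ t → Pr a T (start A t)) (computes-instance x))

-- The reduction of SAT to CIS

-- The index is a bare number rather than an element of `Fin N`, as the system also has literals of
-- a variable outside the formula.
Lit : Set
Lit = Bool × ℕ

_≟ₗ_ : DecidableEquality Lit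
_≟ₗ_ = ≡-dec Bool._≟_ ℕ._≟_

open DecMembership _≟ₗ_ using (_∈?_)

neg : Lit → Lit
neg (b , i) = not b , i

encodeLit : Lit → Tree
encodeLit (b , i) = cons (bit b) (encodeℕ i)

encodeLits : List Lit → Tree
encodeLits ls = encodeList (map encodeLit ls)

contains : List Lit → Lit → Bool
contains C v = does (v ∈? C)

-- The accumulator makes this match the fold in `literalsᵉ` round by round.
literals : ℕ → List Lit → List Lit
literals zero    acc = acc
literals (suc i) acc = literals i ((true , i) ∷ (false , i) ∷ acc)

matrix : (Lit → Lit → Bool) → List Lit → Tree
matrix f vs = encodeList (map (λ u → encodeList (map (bit ∘ f u) vs)) vs)

trueᵉ : ∀ {k} → Exp k
trueᵉ = cons nil nil

isOneᵉ : Exp 2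
isOneᵉ = cond (var 0F) (cond (tail (var 0F)) nil trueᵉ) nil

-- Truncated subtraction detects equality: (1 + j) ∸ i is 1 only for i = j.
sameIndexᵉ : Exp 2
sameIndexᵉ = call isOneᵉ (fold (tail (var 0F)) (cons nil (tail (var 1F))) (tail (var 1F))) nil

sameᵉ : Exp 2
sameᵉ = cond (head (var 0F)) (cond (head (var 1F)) sameIndexᵉ nil)
                             (cond (head (var 1F)) nil sameIndexᵉ)

containsᵉ : Exp 2
containsᵉ = fold (var 0F) nil (cond (call sameᵉ (var 3F) (head (var 0F))) trueᵉ (var 1F))

rowᵉ : Exp 2
rowᵉ = fold (var 1F) nil (cons (call containsᵉ (var 2F) (head (var 0F))) (var 1F))

replicateᵉ : Exp 2
replicateᵉ = fold (var 1F) nil (cons (var 2F) (var 1F))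

-- The edges of a clause digraph depend only on their target, so all rows coincide: one is computed
-- and then copied once per vertex.
clauseᵉ : Exp 2
clauseᵉ = call replicateᵉ (call rowᵉ (var 0F) (var 1F)) (var 1F)

negᵉ : ∀ {k} → Exp k → Exp k
negᵉ e = cons (cond (head e) nil trueᵉ) (tail e)

-- The row of a literal in `G₀` is that of the one-literal clause consisting of its negation, so
-- `rowᵉ` serves here too.
conflictᵉ : Exp 2
conflictᵉ = fold (var 0F) nil (cons (call rowᵉ (cons (negᵉ (head (var 0F))) nil) (var 2F)) (var 1F))

systemᵉ : Exp 2
systemᵉ = cons (call conflictᵉ (var 1F) nil)
  -- The tail of the encoded formula is its list of clauses; the list of all literals is put in
  -- front as a further clause.
  (fold (cons (var 1F) (tail (var 0F))) nil (cons (call clauseᵉ (head (var 0F)) (var 3F)) (var 1F)))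

literalsᵉ : Exp 1
-- The added cell turns `N` into `N + 1`, which makes room for the dummy variable. The tail of the
-- remaining spine is the index of the current variable in unary.
literalsᵉ = fold (cons nil (head (var 0F))) nil
  (cons (cons trueᵉ (tail (var 0F))) (cons (cons nil (tail (var 0F))) (var 1F)))

reductionᵉ : Exp 1
reductionᵉ = call systemᵉ (var 0F) literalsᵉ

foldTree-tail : ∀ i j → foldTree (λ _ a → tl a) (encodeℕ i) (encodeℕ j) ≡ encodeℕ (j ℕ.∸ i)
foldTree-tail zero    j       = refl
foldTree-tail (suc i) zero    = trans (foldTree-tail i zero) (cong encodeℕ (0∸n≡0 i))
foldTree-tail (suc i) (suc j) = foldTree-tail i j

eval-isOne : ∀ i j → eval isOneᵉ (encodeℕ (suc j ℕ.∸ i) ∷ nil ∷ []) ≡ bit (does (i ℕ.≟ j))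
eval-isOne zero    zero    = refl
eval-isOne zero    (suc j) = refl
eval-isOne (suc i) zero    rewrite 0∸n≡0 i = refl
eval-isOne (suc i) (suc j) = eval-isOne i j

eval-sameIndex : ∀ t u i j →
  eval sameIndexᵉ (cons t (encodeℕ i) ∷ cons u (encodeℕ j) ∷ []) ≡ bit (does (i ℕ.≟ j))
eval-sameIndex t u i j = trans
  (cong (λ t → eval isOneᵉ (t ∷ nil ∷ [])) (foldTree-tail i (suc j)))
  (eval-isOne i j)

does-≟ₗ : ∀ b i j → does ((b , i) ≟ₗ (b , j)) ≡ does (i ℕ.≟ j)
does-≟ₗ true  i j with i ℕ.≟ j
... | yes _ = refl
... | no  _ = refl
does-≟ₗ false i j with i ℕ.≟ j
... | yes _ = refl
... | no  _ = refl

eval-same : ∀ l m → eval sameᵉ (encodeLit l ∷ encodeLit m ∷ []) ≡ bit (does (l ≟ₗ m))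
eval-same (true  , i) (true  , j) =
  trans (eval-sameIndex (bit true) (bit true) i j) (cong bit (sym (does-≟ₗ true i j)))
eval-same (true  , i) (false , j) = refl
eval-same (false , i) (true  , j) = refl
eval-same (false , i) (false , j) =
  trans (eval-sameIndex (bit false) (bit false) i j) (cong bit (sym (does-≟ₗ false i j)))

eval-contains : ∀ C v → eval containsᵉ (encodeLits C ∷ encodeLit v ∷ []) ≡ bit (contains C v)
eval-contains C v = trans (go C false) (cong bit (Bool.∨-identityʳ _))
  where
  step′ : Tree → Tree → Tree
  step′ s a = if isTrue (eval sameᵉ (encodeLit v ∷ hd s ∷ [])) then bit true else a

  go : ∀ D b → foldTree step′ (encodeLits D) (bit b) ≡ bit (contains D v ∨ b)
  go []      b = refl
  go (l ∷ D) b rewrite eval-same v l with does (v ≟ₗ l)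
  ... | true  = trans (go D true) (cong bit (Bool.∨-zeroʳ (contains D v)))
  ... | false = go D b

-- Covers the folds that push one entry per element onto the accumulator; the entry pushed last
-- comes first, hence the `reverse`.
foldTree-map : ∀ {X : Set} (f : Tree → Tree → Tree) (e g : X → Tree) →
  (∀ x t a → f (cons (e x) t) a ≡ cons (g x) a) →
  ∀ xs → foldTree f (encodeList (map e xs)) nil ≡ encodeList (map g (reverse xs))
foldTree-map f e g f≡ xs = trans (go xs []) (cong encodeList (sym (reverse-map g xs)))
  where
  go : ∀ xs as → foldTree f (encodeList (map e xs)) (encodeList as) ≡ encodeList (map g xs ʳ++ as)
  go []       as = refl
  go (x ∷ xs) as = trans (cong (foldTree f (encodeList (map e xs))) (f≡ x _ _)) (go xs (g x ∷ as))

eval-row : ∀ C L → eval rowᵉ (encodeLits C ∷ encodeLits L ∷ [])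
                 ≡ encodeList (map (bit ∘ contains C) (reverse L))
eval-row C L = foldTree-map _ encodeLit _ (λ v t a → cong (λ t → cons t a) (eval-contains C v)) L

eval-clause : ∀ C L → eval clauseᵉ (encodeLits C ∷ encodeLits L ∷ [])
                    ≡ matrix (λ _ → contains C) (reverse L)
eval-clause C L = foldTree-map _ encodeLit _ (λ v t a → cong (λ t → cons t a) (eval-row C L)) L

eval-neg : ∀ l → eval (negᵉ {1} (var 0F)) (encodeLit l ∷ []) ≡ encodeLit (neg l)
eval-neg (true  , i) = refl
eval-neg (false , i) = refl

conflict : Lit → Lit → Bool
conflict u = contains (neg u ∷ [])

eval-conflict : ∀ L t → eval conflictᵉ (encodeLits L ∷ t ∷ []) ≡ matrix conflict (reverse L)
eval-conflict L t = foldTree-map _ encodeLit _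
  (λ u _ a → cong (λ t → cons t a)
    (trans (cong (λ t → eval rowᵉ (cons t nil ∷ encodeLits L ∷ [])) (eval-neg u)) (eval-row (neg u ∷ []) L)))
  L

eval-literals : ∀ N t → eval literalsᵉ (cons (encodeℕ N) t ∷ []) ≡ encodeLits (literals (suc N) [])
eval-literals N t = go (suc N) []
  where
  go : ∀ M acc → foldTree (λ s a → cons (cons (bit true) (tl s)) (cons (cons (bit false) (tl s)) a))
    (encodeℕ M) (encodeLits acc) ≡ encodeLits (literals M acc)
  go zero    acc = refl
  go (suc M) acc = go M ((true , M) ∷ (false , M) ∷ acc)

eval-system : ∀ t Cs L → eval systemᵉ (cons t (encodeList (map encodeLits Cs)) ∷ encodeLits L ∷ [])
  ≡ encodeList (matrix conflict (reverse L) ∷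
                map (λ C → matrix (λ _ → contains C) (reverse L)) (reverse (L ∷ Cs)))
eval-system t Cs L = cong₂ cons (eval-conflict L nil)
  (foldTree-map _ encodeLits _ (λ C _ a → cong (λ t → cons t a) (eval-clause C L)) (L ∷ Cs))

encodeDigraph-lookup : ∀ f vs →
  encodeDigraph (λ u v → f (lookup vs u) (lookup vs v)) ≡ matrix f vs
encodeDigraph-lookup f vs = cong encodeList (trans
  (tabulate-cong (λ u → cong encodeList (tabulate-map (bit ∘ f (lookup vs u)) vs)))
  (tabulate-map (λ u → encodeList (map (bit ∘ f u) vs)) vs))
  where
  tabulate-map : ∀ {X Y : Set} (g : X → Y) xs → tabulate (g ∘ lookup xs) ≡ map g xs
  tabulate-map g xs = trans (sym (map-tabulate (lookup xs) g)) (cong (map g) (tabulate-lookup xs))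

does-true⁻ : ∀ {P : Set} (p? : Dec P) → does p? ≡ true → P
does-true⁻ (yes p) _ = p

neg-≢ : ∀ l → l ≢ neg l
neg-≢ (true  , _) ()
neg-≢ (false , _) ()

neg-sym : ∀ {l m} → m ∈ neg l ∷ [] → l ∈ neg m ∷ []
neg-sym {b , i} (here refl) = here (cong (_, i) (sym (Bool.not-involutive b)))

contains⁺ : ∀ C v → v ∈ C → contains C v ≡ true
contains⁺ C v = dec-true (v ∈? C)

contains⁻ : ∀ C v → contains C v ≡ true → v ∈ C
contains⁻ C v = does-true⁻ (v ∈? C)

¬contains⁺ : ∀ C v → ¬ v ∈ C → contains C v ≡ false
¬contains⁺ C v = dec-false (v ∈? C)

conflict-sym : ∀ u v → conflict u v ≡ conflict v u
conflict-sym u v = does-⇔ (mk⇔ neg-sym neg-sym) (v ∈? neg u ∷ []) (u ∈? neg v ∷ [])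

literals⁺ˡ : ∀ M {acc l} → l ∈ acc → l ∈ literals M acc
literals⁺ˡ zero    l∈ = l∈
literals⁺ˡ (suc M) l∈ = literals⁺ˡ M (there (there l∈))

∈-literals : ∀ M {acc b i} → i < M → (b , i) ∈ literals M acc
∈-literals (suc M) {b = b} i<1+M with m≤n⇒m<n∨m≡n (≤-pred i<1+M)
... | inj₁ i<M = ∈-literals M i<M
∈-literals (suc M) {b = true}  _ | inj₂ refl = literals⁺ˡ M (here refl)
∈-literals (suc M) {b = false} _ | inj₂ refl = literals⁺ˡ M (there (here refl))

length-literals : ∀ M acc → length (literals M acc) ≡ M + M + length acc
length-literals zero    acc = refl
length-literals (suc M) acc = trans (length-literals M _) (begin
  M + M + (2 + length acc)        ≡⟨ +-suc (M + M) _ ⟩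
  suc (M + M + suc (length acc))  ≡⟨ cong suc (+-suc (M + M) _) ⟩
  2 + (M + M + length acc)        ≡⟨ cong (λ k → suc (k + length acc)) (+-suc M M) ⟨
  suc M + suc M + length acc      ∎)
  where open ≡-Reasoning

toLit : ∀ {N} → Literal N → Lit
toLit = map₂ toℕ

module SystemOf (N : ℕ) (Cs : List (Clause N)) where

  -- The variable N does not occur in the formula; it makes the system non-empty for N = 0.
  allLiterals : List Lit
  allLiterals = literals (suc N) []

  -- Reversed because a fold builds its result back to front; likewise for the digraphs.
  vertices : List Lit
  vertices = reverse allLiterals

  -- The clause of all literals ensures that there is at least one digraph.
  clauseLits : List (List Lit)
  clauseLits = allLiterals ∷ map (map toLit) Cs

  digraphs : List (List Lit)
  digraphs = reverse clauseLits

  system : GraphSystem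
  system = record
    { n           = length vertices
    ; m           = length digraphs
    ; m≥1         = subst (1 ≤_) (sym (length-reverse clauseLits)) (s≤s z≤n)
    ; G₀          = λ u v → conflict (lookup vertices u) (lookup vertices v)
    ; symmetric   = λ u v → conflict-sym (lookup vertices u) (lookup vertices v)
    ; irreflexive = λ u → ¬contains⁺ (neg (lookup vertices u) ∷ []) (lookup vertices u)
                            (λ { (here e) → neg-≢ _ e })
    ; G           = λ i u v → contains (lookup digraphs i) (lookup vertices v)
    }

  encode-system : encodeSystem system ≡
    encodeList (matrix conflict vertices ∷ map (λ C → matrix (λ _ → contains C) vertices) digraphs)
  encode-system = cong encodeList (cong₂ _∷_ (encodeDigraph-lookup conflict vertices) (begin
    tabulate (λ i → encodeDigraph (GraphSystem.G system i))
      ≡⟨ tabulate-cong (λ i → encodeDigraph-lookup (λ _ → contains (lookup digraphs i)) vertices) ⟩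
    tabulate (λ i → matrix (λ _ → contains (lookup digraphs i)) vertices)
      ≡⟨ map-tabulate (lookup digraphs) (λ C → matrix (λ _ → contains C) vertices) ⟨
    map (λ C → matrix (λ _ → contains C) vertices) (tabulate (lookup digraphs))
      ≡⟨ cong (map _) (tabulate-lookup digraphs) ⟩
    map (λ C → matrix (λ _ → contains C) vertices) digraphs ∎))
    where open ≡-Reasoning

  vertexOf : ∀ b {i} → i < suc N → ∃ λ u → lookup vertices u ≡ (b , i)
  vertexOf b i≤N = Any.index l∈ , sym (lookup-index l∈)
    where l∈ = Any.reverse⁺ (∈-literals (suc N) {b = b} i≤N)

  module _ (a : Fin N → Bool) (sat : All (Any (λ l → a (proj₂ l) ≡ proj₁ l)) Cs) where

    value : ℕ → Bool
    value i with i ℕ.<? N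
    ... | yes i<N = a (fromℕ< i<N)
    -- The dummy variable is set to true; either value would do.
    ... | no  _   = true

    value-toℕ : ∀ i → value (toℕ i) ≡ a i
    value-toℕ i with toℕ i ℕ.<? N
    ... | yes i<N = cong a (Fin.fromℕ<-toℕ i i<N)
    ... | no  i≮N = contradiction (Fin.toℕ<n i) i≮N

    TrueLit : Lit → Set
    TrueLit (b , i) = value i ≡ b

    trueLit? : ∀ l → Dec (TrueLit l)
    trueLit? (b , i) = value i Bool.≟ b

    trueVertices : Subset (length vertices)
    trueVertices = Vec.tabulate (λ u → does (trueLit? (lookup vertices u)))

    trueVertices⁺ : ∀ u → TrueLit (lookup vertices u) → u Subset.∈ trueVertices
    trueVertices⁺ u p = lookup⇒[]= u _ (trans (lookup∘tabulate _ u) (dec-true (trueLit? _) p))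

    trueVertices⁻ : ∀ u → u Subset.∈ trueVertices → TrueLit (lookup vertices u)
    trueVertices⁻ u u∈ = does-true⁻ (trueLit? _) (trans (sym (lookup∘tabulate _ u)) ([]=⇒lookup u∈))

    trueVertex : ∀ {i} → i < suc N → ∃ λ u → u Subset.∈ trueVertices × lookup vertices u ≡ (value i , i)
    trueVertex {i} i≤N with u , e ← vertexOf (value i) i≤N =
      u , trueVertices⁺ u (subst TrueLit (sym e) refl) , e

    trueLit-in : ∀ {C} → C ∈ clauseLits → ∃ λ i → i < suc N × (value i , i) ∈ C
    -- For `N = 0` variable 0 is the dummy, so the clause of all literals has a true literal even
    -- then.
    trueLit-in (here refl) = 0 , s≤s z≤n , ∈-literals (suc N) (s≤s z≤n)
    trueLit-in (there C∈)
      with D , D∈Cs , refl ← ∈-map⁻ (map toLit) C∈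
      with (b , i) , l∈D , refl ← find (All.lookup sat D∈Cs)
      = toℕ i , m<n⇒m<1+n (Fin.toℕ<n i) ,
        subst (λ b → (b , toℕ i) ∈ map toLit D) (sym (value-toℕ i)) (∈-map⁺ toLit l∈D)

    neg-¬TrueLit : ∀ l → TrueLit l → ¬ TrueLit (neg l)
    neg-¬TrueLit l p q = Bool.not-¬ p q

    satisfying⇒GIS : IsGIS system trueVertices
    satisfying⇒GIS = nonempty , independent , good
      where
      nonempty : Subset.Nonempty trueVertices
      nonempty with u , u∈ , _ ← trueVertex {0} (s≤s z≤n) = u , u∈

      independent : Independent system trueVertices
      independent u v u∈ v∈ = ¬contains⁺ (neg (lookup vertices u) ∷ []) (lookup vertices v) λ { (here e) →
        neg-¬TrueLit (lookup vertices u) (trueVertices⁻ u u∈) (subst TrueLit e (trueVertices⁻ v v∈)) }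

      good : ∀ u → u Subset.∈ trueVertices → Good system trueVertices u
      good u _ j
        with i , i≤N , l∈C ← trueLit-in (Any.reverse⁻ {xs = clauseLits} (∈-lookup {xs = digraphs} j))
        with v , v∈ , e ← trueVertex i≤N
        = v , v∈ , contains⁺ (lookup digraphs j) (lookup vertices v) (subst (_∈ lookup digraphs j) (sym e) l∈C)

  module _ (Γ : Subset (length vertices)) (gis : IsGIS system Γ) where
    private
      u₀          = proj₁ (proj₁ gis)
      u₀∈Γ        = proj₂ (proj₁ gis)
      independent = proj₁ (proj₂ gis)
      good        = proj₂ (proj₂ gis)

    Chosen : Lit → Set
    Chosen l = ∃ λ v → v Subset.∈ Γ × lookup vertices v ≡ l

    chosen? : ∀ l → Dec (Chosen l)
    chosen? l = Fin.any? (λ v → (v ∈ₛ? Γ) ×-dec (lookup vertices v ≟ₗ l))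

    chosen-consistent : ∀ l → Chosen l → ¬ Chosen (neg l)
    chosen-consistent l (u , u∈ , refl) (v , v∈ , e) =
      case-false (trans (sym (contains⁺ (neg (lookup vertices u) ∷ []) (lookup vertices v) (here e)))
                        (independent u v u∈ v∈))
      where
      case-false : true ≢ false
      case-false ()

    -- One vertex `u₀` of `Γ` is enough: its edge in the digraph of `C` ends in a chosen literal of
    -- `C`, whatever `u₀` is.
    chosen-in : ∀ {C} → C ∈ Cs → ∃ λ l → l ∈ C × Chosen (toLit l)
    chosen-in {C} C∈
      with C∈digraphs ← Any.reverse⁺ (there {x = allLiterals} (∈-map⁺ (map toLit) C∈))
      with v , v∈ , e ← good u₀ u₀∈Γ (Any.index C∈digraphs)
      with l , l∈C , e′ ← ∈-map⁻ toLit (subst (lookup vertices v ∈_) (sym (lookup-index C∈digraphs))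
             (contains⁻ (lookup digraphs (Any.index C∈digraphs)) (lookup vertices v) e))
      = l , l∈C , v , v∈ , e′

    -- A variable with neither literal chosen becomes false; this is harmless as every clause
    -- contains a chosen literal.
    assignment : Fin N → Bool
    assignment i = does (chosen? (true , toℕ i))

    assignment-chosen : ∀ l → Chosen (toLit l) → assignment (proj₂ l) ≡ proj₁ l
    assignment-chosen (true  , i) p = dec-true (chosen? _) p
    assignment-chosen (false , i) p = dec-false (chosen? _) (λ q → chosen-consistent _ q p)

    GIS⇒satisfying : All (Any (λ l → assignment (proj₂ l) ≡ proj₁ l)) Cs
    GIS⇒satisfying = All.tabulate λ C∈ →
      let l , l∈C , p = chosen-in C∈ in lose l∈C (assignment-chosen l p)

abstract
  SAT-to-CIS : ∀ k → Reduction (SAT k) CIS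
  SAT-to-CIS k = record
    { instanceOf        = λ φ → SystemOf.system (Formula.N φ) (Formula.clauses φ)
    ; code              = reductionᵉ
    ; computes-instance = computes-system
    ; sound             = λ φ (Γ , gis) → let open SystemOf (Formula.N φ) (Formula.clauses φ) in
                            assignment Γ gis , GIS⇒satisfying Γ gis
    ; adequate          = λ φ (a , sat) → let open SystemOf (Formula.N φ) (Formula.clauses φ) in
                            trueVertices a sat , satisfying⇒GIS a sat
    }
    where
    computes-system : ∀ φ → eval reductionᵉ (encodeFormula {k} φ ∷ []) ≡
      encodeSystem (SystemOf.system (Formula.N φ) (Formula.clauses φ))
    computes-system φ = begin
      eval systemᵉ (encodeFormula φ ∷ eval literalsᵉ (encodeFormula φ ∷ []) ∷ [])
        ≡⟨ cong₂ (λ t u → eval systemᵉ (t ∷ u ∷ [])) (cong (cons (encodeℕ N) ∘ encodeList) clauses≡)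
             (eval-literals N (encodeList (map (λ C → encodeList (map encodeLiteral C)) clauses))) ⟩
      eval systemᵉ (cons (encodeℕ N) (encodeList (map encodeLits (map (map toLit) clauses))) ∷
                    encodeLits allLiterals ∷ [])
        ≡⟨ eval-system (encodeℕ N) (map (map toLit) clauses) allLiterals ⟩
      encodeList (matrix conflict vertices ∷ map (λ C → matrix (λ _ → contains C) vertices) digraphs)
        ≡⟨ encode-system ⟨
      encodeSystem system ∎
      where
      open ≡-Reasoning
      open Formula φ
      open SystemOf N clauses
      clauses≡ : map (λ C → encodeList (map encodeLiteral C)) clauses ≡
                 map encodeLits (map (map toLit) clauses)
      clauses≡ = trans (map-cong (λ C → cong encodeList (map-∘ C)) clauses) (map-∘ clauses)

-- Polynomial time

weight : Tree → ℕ
weight nil        = 0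
weight (cons t u) = suc (weight t + weight u)

weight-hd : ∀ t → weight (hd t) ≤ weight t
weight-hd nil        = z≤n
weight-hd (cons t u) = m≤n⇒m≤1+n (m≤m+n _ _)

weight-tl : ∀ t → weight (tl t) ≤ weight t
weight-tl nil        = z≤n
weight-tl (cons t u) = m≤n⇒m≤1+n (m≤n+m _ _)

weight-bit : ∀ b → weight (bit b) ≤ 1
weight-bit false = z≤n
weight-bit true  = ≤-refl

weight-encodeℕ : ∀ n → weight (encodeℕ n) ≡ n
weight-encodeℕ zero    = refl
weight-encodeℕ (suc n) = cong suc (weight-encodeℕ n)

weight-encodeList : ∀ {B} ts → All (λ t → weight t ≤ B) ts → weight (encodeList ts) ≤ length ts * suc B
weight-encodeList []       []       = z≤n
weight-encodeList (t ∷ ts) (p ∷ ps) = s≤s (+-mono-≤ p (weight-encodeList ts ps))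

-- The spine only gets smaller, so `S` bounds it in every round. The bound `B` has to hold for
-- arbitrary accumulators; the loop bodies of the reduction allow this because they never traverse
-- theirs, and no estimate of how accumulators grow is required. The 3 is the loop test and the two
-- closing assignments.
foldTime-≤ : ∀ {f τ B S} l a → weight l ≤ S → (∀ s a → weight s ≤ S → τ s a ≤ B) →
  foldTime f τ l a ≤ suc (S * (B + 3))
foldTime-≤ {f} {τ} {B} {S} l a l≤S τ≤B =
  ≤-trans (go l a l≤S) (s≤s (*-monoˡ-≤ (B + 3) l≤S))
  where
  arith : ∀ t B → (B + 2) + suc (t * (B + 3)) ≡ (B + 3) + t * (B + 3)
  arith = solve-∀

  go : ∀ l a → weight l ≤ S → foldTime f τ l a ≤ suc (weight l * (B + 3))
  go nil        a l≤S = ≤-refl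
  go (cons h t) a l≤S = s≤s (begin
    τ (cons h t) a + 2 + foldTime f τ t _      ≤⟨ +-mono-≤ (+-monoˡ-≤ 2 (τ≤B _ a l≤S))
                                                   (go t _ (≤-trans (weight-tl (cons h t)) l≤S)) ⟩
    (B + 2) + suc (weight t * (B + 3))         ≡⟨ arith (weight t) B ⟩
    (B + 3) + weight t * (B + 3)               ≤⟨ +-monoʳ-≤ (B + 3) (*-monoˡ-≤ (B + 3) (m≤n+m _ (weight h))) ⟩
    (B + 3) + (weight h + weight t) * (B + 3)  ∎)
    where open ≤-Reasoning

if-≤ : ∀ b {m n B} → m ≤ B → n ≤ B → (if b then m else n) ≤ B
if-≤ true  m≤B n≤B = m≤B
if-≤ false m≤B n≤B = n≤B

-- Each bound repeats the shape of `time` for its expression, with `S` bounding the weight of the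
-- arguments and folds estimated by `foldTime-≤`. In `conflictBound`, `3 + S` bounds the one-literal
-- clause of a negated literal; in `systemBound`, `suc (S + S)` bounds the clause list with all
-- literals added.
sameIndexBound sameBound containsBound rowBound replicateBound clauseBound conflictBound systemBound
  literalsBound reductionBound : ℕ → ℕ

sameIndexBound S = (4 + (2 + suc (S * 5))) + 10
sameBound      S = 2 + suc (2 + suc (sameIndexBound S))
containsBound  S = 1 + (1 + suc (S * (1 + (2 + (sameBound S + 1)) + 4 + 3)))
rowBound       S = 1 + (1 + suc (S * (1 + (2 + (containsBound S + 1)) + 2 + 3)))
replicateBound S = 1 + (1 + suc (S * 6))
clauseBound    S = 1 + (1 + (rowBound S + 1)) + (1 + (replicateBound S + 1))
conflictBound  S = 1 + (1 + suc (S * (13 + (1 + (rowBound (3 + S) + 1)) + 2 + 3)))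
systemBound    S = 1 + (1 + (conflictBound S + 1)) +
  (1 + (4 + suc (suc (S + S) * (2 + (1 + (clauseBound (suc (S + S)) + 1)) + 2 + 3))) + 1)
literalsBound  S = 1 + (4 + suc (suc S * 16))
reductionBound S = 1 + (literalsBound S + (systemBound S + 1))

time-isOne : ∀ ρ → time isOneᵉ ρ ≤ 8
time-isOne (nil                    ∷ _ ∷ []) = s≤s (s≤s (s≤s z≤n))
time-isOne (cons _ nil             ∷ _ ∷ []) = ≤-refl
time-isOne (cons _ (cons _ _)      ∷ _ ∷ []) = m≤m+n 6 2

time-sameIndex : ∀ {S} l m → weight l ≤ S → time sameIndexᵉ (l ∷ m ∷ []) ≤ sameIndexBound S
time-sameIndex l m l≤S = +-mono-≤
  (+-monoʳ-≤ 4 (+-monoʳ-≤ 2 (foldTime-≤ (tl l) _ (≤-trans (weight-tl l) l≤S) (λ _ _ _ → ≤-refl))))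
  (s≤s (+-monoˡ-≤ 1 (time-isOne (_ ∷ nil ∷ []))))

time-same : ∀ {S} l m → weight l ≤ S → time sameᵉ (l ∷ m ∷ []) ≤ sameBound S
time-same {S} l m l≤S = +-monoʳ-≤ 2 (s≤s (if-≤ (isTrue (hd l))
  (+-monoʳ-≤ 2 (s≤s (if-≤ (isTrue (hd m)) index 1≤)))
  (+-monoʳ-≤ 2 (s≤s (if-≤ (isTrue (hd m)) 1≤ index)))))
  where
  index = time-sameIndex l m l≤S
  1≤ : 1 ≤ sameIndexBound S
  1≤ = s≤s z≤n

time-contains : ∀ {S} C v → weight C ≤ S → weight v ≤ S → time containsᵉ (C ∷ v ∷ []) ≤ containsBound S
time-contains C v C≤S v≤S = +-monoʳ-≤ 2 (foldTime-≤ C nil C≤S (λ s a _ →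
  +-mono-≤ (+-monoʳ-≤ 3 (+-monoˡ-≤ 1 (time-same v (hd s) v≤S)))
           (s≤s (if-≤ (isTrue (eval sameᵉ (v ∷ hd s ∷ []))) ≤-refl (s≤s z≤n)))))

time-row : ∀ {S} C L → weight C ≤ S → weight L ≤ S → time rowᵉ (C ∷ L ∷ []) ≤ rowBound S
time-row C L C≤S L≤S = +-monoʳ-≤ 2 (foldTime-≤ L nil L≤S (λ s a s≤S →
  +-monoˡ-≤ 2 (+-monoʳ-≤ 3 (+-monoˡ-≤ 1 (time-contains C (hd s) C≤S (≤-trans (weight-hd s) s≤S))))))

time-replicate : ∀ {S} r L → weight L ≤ S → time replicateᵉ (r ∷ L ∷ []) ≤ replicateBound S
time-replicate r L L≤S = +-monoʳ-≤ 2 (foldTime-≤ L nil L≤S (λ _ _ _ → ≤-refl))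

time-clause : ∀ {S} C L → weight C ≤ S → weight L ≤ S → time clauseᵉ (C ∷ L ∷ []) ≤ clauseBound S
time-clause C L C≤S L≤S = +-mono-≤
  (+-monoʳ-≤ 2 (+-monoˡ-≤ 1 (time-row C L C≤S L≤S)))
  (s≤s (+-monoˡ-≤ 1 (time-replicate _ L L≤S)))

weight-negᵉ : ∀ {k S} (e : Exp k) ρ → weight (eval e ρ) ≤ S → weight (cons (eval (negᵉ e) ρ) nil) ≤ 3 + S
weight-negᵉ {S = S} e ρ e≤S = s≤s (begin
  suc (weight b + weight (tl (eval e ρ))) + 0  ≡⟨ +-identityʳ _ ⟩
  suc (weight b + weight (tl (eval e ρ)))      ≤⟨ s≤s (+-mono-≤ b≤1 (≤-trans (weight-tl (eval e ρ)) e≤S)) ⟩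
  2 + S                                        ∎)
  where
  open ≤-Reasoning
  b = if isTrue (hd (eval e ρ)) then nil else cons nil nil
  b≤1 : weight b ≤ 1
  b≤1 with isTrue (hd (eval e ρ))
  ... | true  = z≤n
  ... | false = ≤-refl

time-conflict : ∀ {S} L t → weight L ≤ S → time conflictᵉ (L ∷ t ∷ []) ≤ conflictBound S
time-conflict {S} L t L≤S = +-monoʳ-≤ 2 (foldTime-≤ L nil L≤S (λ s a s≤S →
  +-monoˡ-≤ 2 (+-mono-≤
    (+-monoˡ-≤ 2 (+-monoˡ-≤ 4 (+-monoʳ-≤ 3 (s≤s (if-≤ (isTrue (hd (hd s))) (s≤s z≤n) ≤-refl)))))
    (+-monoʳ-≤ 1 (+-monoˡ-≤ 1 (time-row (cons (eval (negᵉ (head (var 0F))) (s ∷ a ∷ L ∷ t ∷ [])) nil) L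
      (weight-negᵉ (head (var 0F)) (s ∷ a ∷ L ∷ t ∷ []) (≤-trans (weight-hd s) s≤S)) (m≤n⇒m≤o+n 3 L≤S)))))))

time-system : ∀ {S} t L → weight t ≤ S → weight L ≤ S → time systemᵉ (t ∷ L ∷ []) ≤ systemBound S
time-system {S} t L t≤S L≤S = +-mono-≤
  (+-monoʳ-≤ 2 (+-monoˡ-≤ 1 (time-conflict L nil L≤S)))
  (+-monoˡ-≤ 1 (+-monoʳ-≤ 5 (foldTime-≤ (cons L (tl t)) nil
    (s≤s (+-mono-≤ L≤S (≤-trans (weight-tl t) t≤S)))
    (λ s a s≤ → +-monoˡ-≤ 2 (+-monoʳ-≤ 3 (+-monoˡ-≤ 1
      (time-clause (hd s) L (≤-trans (weight-hd s) s≤) (m≤n⇒m≤1+n (≤-trans L≤S (m≤m+n S S))))))))))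

time-literals : ∀ {S} t → weight t ≤ S → time literalsᵉ (t ∷ []) ≤ literalsBound S
time-literals t t≤S = +-monoʳ-≤ 5 (foldTime-≤ {B = 13} (cons nil (hd t)) nil
  (s≤s (≤-trans (weight-hd t) t≤S)) (λ _ _ _ → ≤-refl))

time-reduction : ∀ {S} t → weight t ≤ S → weight (eval literalsᵉ (t ∷ [])) ≤ S →
  time reductionᵉ (t ∷ []) ≤ reductionBound S
time-reduction t t≤S L≤S = s≤s (+-mono-≤ (time-literals t t≤S)
  (+-monoˡ-≤ 1 (time-system t _ t≤S L≤S)))

PolyBounded : (ℕ → ℕ) → Set
PolyBounded f = ∃ λ e → ∀ n → f n ≤ (2 + n) ℕ.^ e

poly-id : PolyBounded (λ n → n)
poly-id = 1 , λ n → ≤-trans (m≤n+m n 2) (≤-reflexive (sym (*-identityʳ (2 + n))))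

poly-* : ∀ {f g} → PolyBounded f → PolyBounded g → PolyBounded (λ n → f n * g n)
poly-* (d , p) (e , q) = d + e , λ n →
  ≤-trans (*-mono-≤ (p n) (q n)) (≤-reflexive (sym (^-distribˡ-+-* (2 + n) d e)))

poly-+ : ∀ {f g} → PolyBounded f → PolyBounded g → PolyBounded (λ n → f n + g n)
poly-+ {f} {g} (d , p) (e , q) = suc (d + e) , λ n → let x = 2 + n in begin
  f n + g n                      ≤⟨ +-mono-≤ (p n) (q n) ⟩
  x ℕ.^ d + x ℕ.^ e              ≤⟨ +-mono-≤ (^-monoʳ-≤ x (m≤m+n d e)) (^-monoʳ-≤ x (m≤n+m e d)) ⟩
  x ℕ.^ (d + e) + x ℕ.^ (d + e)  ≡⟨ cong (x ℕ.^ (d + e) +_) (+-identityʳ _) ⟨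
  2 * x ℕ.^ (d + e)              ≤⟨ *-monoˡ-≤ (x ℕ.^ (d + e)) (m≤m+n 2 n) ⟩
  x * x ℕ.^ (d + e)              ∎
  where open ≤-Reasoning

poly-const : ∀ c → PolyBounded (λ _ → c)
poly-const zero    = 0 , λ _ → z≤n
poly-const (suc c) = poly-+ {λ _ → 1} (0 , λ _ → ≤-refl) (poly-const c)

poly-^ : ∀ {f} → PolyBounded f → ∀ k → PolyBounded (λ n → f n ℕ.^ k)
poly-^ p zero    = poly-const 1
poly-^ p (suc k) = poly-* p (poly-^ p k)

poly-∘ : ∀ {f g} → PolyBounded f → PolyBounded g → PolyBounded (λ n → f (g n))
poly-∘ {f} {g} (d , p) q with e , r ← poly-^ (poly-+ (poly-const 2) q) d = e , λ n → ≤-trans (p (g n)) (r n)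

module PolyBounds where
  infixl 6 _⊕_
  infixl 7 _⊗_
  _⊕_ = poly-+
  _⊗_ = poly-*
  # = poly-const
  S = poly-id

  sameIndex : PolyBounded sameIndexBound
  sameIndex = (# 4 ⊕ (# 2 ⊕ (# 1 ⊕ S ⊗ # 5))) ⊕ # 10

  same : PolyBounded sameBound
  same = # 2 ⊕ (# 1 ⊕ (# 2 ⊕ (# 1 ⊕ sameIndex)))

  contain : PolyBounded containsBound
  contain = # 1 ⊕ (# 1 ⊕ (# 1 ⊕ S ⊗ (# 1 ⊕ (# 2 ⊕ (same ⊕ # 1)) ⊕ # 4 ⊕ # 3)))

  row : PolyBounded rowBound
  row = # 1 ⊕ (# 1 ⊕ (# 1 ⊕ S ⊗ (# 1 ⊕ (# 2 ⊕ (contain ⊕ # 1)) ⊕ # 2 ⊕ # 3)))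

  clause : PolyBounded clauseBound
  clause = # 1 ⊕ (# 1 ⊕ (row ⊕ # 1)) ⊕ (# 1 ⊕ ((# 1 ⊕ (# 1 ⊕ (# 1 ⊕ S ⊗ # 6))) ⊕ # 1))

  conflicts : PolyBounded conflictBound
  conflicts = # 1 ⊕ (# 1 ⊕ (# 1 ⊕ S ⊗ (# 13 ⊕ (# 1 ⊕ (poly-∘ row (# 3 ⊕ S) ⊕ # 1)) ⊕ # 2 ⊕ # 3)))

  system : PolyBounded systemBound
  system = # 1 ⊕ (# 1 ⊕ (conflicts ⊕ # 1)) ⊕
    (# 1 ⊕ (# 4 ⊕ (# 1 ⊕ (# 1 ⊕ (S ⊕ S)) ⊗
      (# 2 ⊕ (# 1 ⊕ (poly-∘ clause (# 1 ⊕ (S ⊕ S)) ⊕ # 1)) ⊕ # 2 ⊕ # 3))) ⊕ # 1)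

  reduction : PolyBounded reductionBound
  reduction = # 1 ⊕ ((# 1 ⊕ (# 4 ⊕ (# 1 ⊕ (# 1 ⊕ S) ⊗ # 16))) ⊕ (system ⊕ # 1))

-- Exponential against polynomial growth.

^-distribʳ-* : ∀ m n o → (m * n) ℕ.^ o ≡ m ℕ.^ o * n ℕ.^ o
^-distribʳ-* m n zero    = refl
^-distribʳ-* m n (suc o) = trans (cong (m * n *_) (^-distribʳ-* m n o)) (arith m n _ _)
  where
  arith : ∀ m n a b → m * n * (a * b) ≡ m * a * (n * b)
  arith = solve-∀

-- Bernoulli's inequality for `(1 + 1 / q) ^ n` with the denominators cleared.
bernoulli : ∀ q n → (n + q) * q ℕ.^ n ≤ q * suc q ℕ.^ n
bernoulli q zero    = ≤-refl
bernoulli q (suc n) = begin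
  suc (n + q) * (q * q ℕ.^ n)  ≡⟨ *-assoc (suc (n + q)) q _ ⟨
  suc (n + q) * q * q ℕ.^ n    ≤⟨ *-monoˡ-≤ (q ℕ.^ n) (≤-trans (m≤n+m _ n) (≤-reflexive (arith n q))) ⟩
  suc q * (n + q) * q ℕ.^ n    ≡⟨ *-assoc (suc q) (n + q) _ ⟩
  suc q * ((n + q) * q ℕ.^ n)  ≤⟨ *-monoʳ-≤ (suc q) (bernoulli q n) ⟩
  suc q * (q * suc q ℕ.^ n)    ≡⟨ swap (suc q) q _ ⟩
  q * (suc q * suc q ℕ.^ n)    ∎
  where
  open ≤-Reasoning
  arith : ∀ n q → n + suc (n + q) * q ≡ suc q * (n + q)
  arith = solve-∀
  swap : ∀ a b c → a * (b * c) ≡ b * (a * c)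
  swap = solve-∀

-- From `bernoulli` at `suc q`, because `2 + n` is at most `2 * (n + suc q)`.
linear-dominated : ∀ q n → (2 + n) * suc q ℕ.^ n ≤ 2 * suc q * (2 + q) ℕ.^ n
linear-dominated q n = begin
  (2 + n) * suc q ℕ.^ n            ≤⟨ *-monoˡ-≤ (suc q ℕ.^ n) (≤-trans (m≤n+m _ (n + (q + q))) (≤-reflexive (arith n q))) ⟩
  2 * (n + suc q) * suc q ℕ.^ n    ≡⟨ *-assoc 2 (n + suc q) _ ⟩
  2 * ((n + suc q) * suc q ℕ.^ n)  ≤⟨ *-monoʳ-≤ 2 (bernoulli (suc q) n) ⟩
  2 * (suc q * (2 + q) ℕ.^ n)      ≡⟨ *-assoc 2 (suc q) _ ⟨
  2 * suc q * (2 + q) ℕ.^ n        ∎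
  where
  open ≤-Reasoning
  arith : ∀ n q → n + (q + q) + (2 + n) ≡ 2 * (n + suc q)
  arith = solve-∀

-- Polynomials grow more slowly than the powers of 1 + 1 / (1 + q).  The induction on the degree
-- uses (1 + 1 / 3q)² ≤ 1 + 1 / q.
polynomial-dominated : ∀ e q → ∃ λ C → ∀ n → (2 + n) ℕ.^ e * suc q ℕ.^ n ≤ C * (2 + q) ℕ.^ n
polynomial-dominated zero    q = 1 , λ n → *-monoʳ-≤ 1 (^-monoˡ-≤ n (n≤1+n (suc q)))
polynomial-dominated (suc e) q with C , bound ← polynomial-dominated e (2 + 3 * q) =
  2 * Q * C , λ n → *-cancelʳ-≤ _ _ ((Q * Q) ℕ.^ n) {{m^n≢0 (Q * Q) n}} (begin
    (2 + n) * (2 + n) ℕ.^ e * q₁ ℕ.^ n * (Q * Q) ℕ.^ n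
      ≡⟨ cong ((2 + n) * (2 + n) ℕ.^ e * q₁ ℕ.^ n *_) (^-distribʳ-* Q Q n) ⟩
    (2 + n) * (2 + n) ℕ.^ e * q₁ ℕ.^ n * (Q ℕ.^ n * Q ℕ.^ n)
      ≡⟨ rearrange₁ (2 + n) ((2 + n) ℕ.^ e) (q₁ ℕ.^ n) (Q ℕ.^ n) ⟩
    (2 + n) * Q ℕ.^ n * ((2 + n) ℕ.^ e * Q ℕ.^ n) * q₁ ℕ.^ n
      ≤⟨ *-monoˡ-≤ (q₁ ℕ.^ n) (*-mono-≤ (linear-dominated (2 + 3 * q) n) (bound n)) ⟩
    2 * Q * R ℕ.^ n * (C * R ℕ.^ n) * q₁ ℕ.^ n
      ≡⟨ rearrange₂ (2 * Q) C (R ℕ.^ n) (q₁ ℕ.^ n) ⟩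
    2 * Q * C * (R ℕ.^ n * R ℕ.^ n * q₁ ℕ.^ n)
      ≡⟨ cong (λ x → 2 * Q * C * (x * q₁ ℕ.^ n)) (^-distribʳ-* R R n) ⟨
    2 * Q * C * ((R * R) ℕ.^ n * q₁ ℕ.^ n)
      ≡⟨ cong (2 * Q * C *_) (^-distribʳ-* (R * R) q₁ n) ⟨
    2 * Q * C * (R * R * q₁) ℕ.^ n
      ≤⟨ *-monoʳ-≤ (2 * Q * C) (^-monoˡ-≤ n (≤-trans (m≤n+m _ _) (≤-reflexive (square q)))) ⟩
    2 * Q * C * (suc q₁ * (Q * Q)) ℕ.^ n
      ≡⟨ cong (2 * Q * C *_) (^-distribʳ-* (suc q₁) (Q * Q) n) ⟩
    2 * Q * C * (suc q₁ ℕ.^ n * (Q * Q) ℕ.^ n)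
      ≡⟨ *-assoc (2 * Q * C) _ _ ⟨
    2 * Q * C * suc q₁ ℕ.^ n * (Q * Q) ℕ.^ n ∎)
  where
  open ≤-Reasoning
  q₁ = suc q
  Q = suc (2 + 3 * q)
  R = suc Q
  rearrange₁ : ∀ a b c d → a * b * c * (d * d) ≡ a * d * (b * d) * c
  rearrange₁ = solve-∀
  rearrange₂ : ∀ a b c d → a * c * (b * c) * d ≡ a * b * (c * c * d)
  rearrange₂ = solve-∀
  square : ∀ q → 3 * q * q + 5 * q + 2 + suc (suc (2 + 3 * q)) * suc (suc (2 + 3 * q)) * suc q
               ≡ suc (suc q) * (suc (2 + 3 * q) * suc (2 + 3 * q))
  square = solve-∀

-- Counting clauses and measuring encodings.

length-cartesianProductWith : ∀ {X Y Z : Set} (f : X → Y → Z) xs ys →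
  length (cartesianProductWith f xs ys) ≡ length xs * length ys
length-cartesianProductWith f []       ys = refl
length-cartesianProductWith f (x ∷ xs) ys = trans (length-++ (map (f x) ys))
  (cong₂ _+_ (length-map (f x) ys) (length-cartesianProductWith f xs ys))

-- Shorter words are included, since a clause may have fewer than `k` literals.
words : {X : Set} → List X → ℕ → List (List X)
words ls zero    = [] ∷ []
words ls (suc k) = [] ∷ cartesianProductWith _∷_ ls (words ls k)

∈-words : ∀ {X : Set} {ls : List X} k {w} → All (_∈ ls) w → length w ≤ k → w ∈ words ls k
∈-words zero    []       _         = here refl
∈-words (suc k) []       _         = here refl
∈-words (suc k) (p ∷ ps) (s≤s w≤k) = there (∈-cartesianProductWith⁺ _∷_ p (∈-words k ps w≤k))

length-words : ∀ {X : Set} (ls : List X) k → length (words ls k) ≤ suc (length ls) ℕ.^ k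
length-words ls zero    = ≤-refl
length-words ls (suc k) = begin
  suc (length (cartesianProductWith _∷_ ls (words ls k)))
    ≡⟨ cong suc (length-cartesianProductWith _∷_ ls (words ls k)) ⟩
  suc (length ls * length (words ls k))
    ≤⟨ +-mono-≤ (m^n>0 (suc (length ls)) k) (*-monoʳ-≤ (length ls) (length-words ls k)) ⟩
  suc (length ls) ℕ.^ suc k ∎
  where open ≤-Reasoning

Unique-lookup-injective : ∀ {X : Set} {xs : List X} → Unique xs → ∀ i j → lookup xs i ≡ lookup xs j → i ≡ j
Unique-lookup-injective (_ ∷ _)  zero    zero    e = refl
Unique-lookup-injective (p ∷ _)  zero    (suc j) e = contradiction e (All.lookup p (∈-lookup j))
Unique-lookup-injective (p ∷ _)  (suc i) zero    e = contradiction (sym e) (All.lookup p (∈-lookup i))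
Unique-lookup-injective (_ ∷ us) (suc i) (suc j) e = cong suc (Unique-lookup-injective us i j e)

-- Sending each position of `xs` to a position of the same element in `ys` is injective when `xs`
-- has no repetitions.
Unique⇒length≤ : ∀ {X : Set} {xs ys : List X} → Unique xs → (∀ {x} → x ∈ xs → x ∈ ys) → length xs ≤ length ys
Unique⇒length≤ {xs = xs} {ys} u xs⊆ys = Fin.injective⇒≤ {f = position} λ {i} {j} e →
  Unique-lookup-injective u i j (trans (lookup-index (member i))
    (trans (cong (lookup ys) e) (sym (lookup-index (member j)))))
  where
  member : ∀ i → lookup xs i ∈ ys
  member i = xs⊆ys (∈-lookup i)
  position : Fin (length xs) → Fin (length ys)
  position i = Any.index (member i)

allLiteralsOf : ∀ N → List (Literal N)
allLiteralsOf N = cartesianProduct (true ∷ false ∷ []) (allFin N)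

∈-allLiteralsOf : ∀ {N} (l : Literal N) → l ∈ allLiteralsOf N
∈-allLiteralsOf (true  , i) = ∈-cartesianProduct⁺ {xs = true ∷ false ∷ []} (here refl) (∈-allFin i)
∈-allLiteralsOf (false , i) = ∈-cartesianProduct⁺ {xs = true ∷ false ∷ []} (there (here refl)) (∈-allFin i)

length-allLiteralsOf : ∀ N → length (allLiteralsOf N) ≡ N + N
length-allLiteralsOf N = begin
  length (allLiteralsOf N)  ≡⟨ length-cartesianProductWith _,_ (true ∷ false ∷ []) (allFin N) ⟩
  2 * length (allFin N)     ≡⟨ cong (2 *_) (length-tabulate {n = N} _) ⟩
  N + (N + 0)               ≡⟨ cong (N +_) (+-identityʳ N) ⟩
  N + N                     ∎
  where open ≡-Reasoning

-- Distinct clauses of width at most `k` are distinct words over `N + N` literals. Here the ban on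
-- repeated clauses makes the length of a formula polynomial in `N`.
length-clauses : ∀ {k} (φ : Formula k) → let open Formula φ in length clauses ≤ suc (N + N) ℕ.^ k
length-clauses {k} φ = begin
  length clauses                        ≤⟨ Unique⇒length≤ distinct (λ C∈ →
                                             ∈-words k (All.universal ∈-allLiteralsOf _) (All.lookup width C∈)) ⟩
  length (words (allLiteralsOf N) k)    ≤⟨ length-words (allLiteralsOf N) k ⟩
  suc (length (allLiteralsOf N)) ℕ.^ k  ≡⟨ cong (λ n → suc n ℕ.^ k) (length-allLiteralsOf N) ⟩
  suc (N + N) ℕ.^ k                     ∎
  where
  open ≤-Reasoning
  open Formula φ

module _ {k : ℕ} (φ : Formula k) where
  open Formula φ
  open SystemOf N clauses

  length-vertices : length vertices ≡ suc N + suc N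
  length-vertices = trans (length-reverse allLiterals)
    (trans (length-literals (suc N) []) (+-identityʳ _))

  -- The clause of all literals raises the exponent from `k` to `suc k`: one plus the number of
  -- clauses is at most `2 * n ^ k`, and `n` is at least 2.
  digraphs-≤ : length digraphs ≤ length vertices ℕ.^ suc k
  digraphs-≤ = begin
    length digraphs                         ≡⟨ length-reverse clauseLits ⟩
    suc (length (map (map toLit) clauses))  ≡⟨ cong suc (length-map (map toLit) clauses) ⟩
    suc (length clauses)                    ≤⟨ s≤s (length-clauses φ) ⟩
    suc (suc (N + N) ℕ.^ k)                 ≤⟨ +-mono-≤ (m^n>0 n k) (^-monoˡ-≤ k (s≤s (+-monoʳ-≤ N (n≤1+n N)))) ⟩
    n ℕ.^ k + n ℕ.^ k                       ≡⟨ cong (n ℕ.^ k +_) (+-identityʳ _) ⟨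
    2 * n ℕ.^ k                             ≤⟨ *-monoˡ-≤ (n ℕ.^ k) (s≤s (≤-trans (s≤s z≤n) (m≤n+m (suc N) N))) ⟩
    n ℕ.^ suc k                             ≡⟨ cong (ℕ._^ suc k) length-vertices ⟨
    length vertices ℕ.^ suc k               ∎
    where
    open ≤-Reasoning
    n = suc N + suc N

  -- A literal in a list weighs at most `3 + N`: its spine cell, its own cell, its sign, and an
  -- index of at most `N` in unary.
  formulaWeight : ℕ
  formulaWeight = suc (N + suc (N + N) ℕ.^ k * suc (k * (3 + N)))

  literalsWeight : ℕ
  literalsWeight = (suc N + suc N) * (3 + N)

  weight-encodeFormula : weight (encodeFormula φ) ≤ formulaWeight
  weight-encodeFormula = s≤s (+-mono-≤ (≤-reflexive (weight-encodeℕ N)) (begin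
    weight (encodeList (map encodeClause clauses))
      ≤⟨ weight-encodeList _ (All.map⁺ (All.map weight-clause width)) ⟩
    length (map encodeClause clauses) * suc (k * (3 + N))
      ≡⟨ cong (_* suc (k * (3 + N))) (length-map encodeClause clauses) ⟩
    length clauses * suc (k * (3 + N))
      ≤⟨ *-monoˡ-≤ (suc (k * (3 + N))) (length-clauses φ) ⟩
    suc (N + N) ℕ.^ k * suc (k * (3 + N)) ∎))
    where
    open ≤-Reasoning
    encodeClause : Clause N → Tree
    encodeClause C = encodeList (map encodeLiteral C)

    weight-literal : ∀ l → weight (encodeLiteral {N} l) ≤ 2 + N
    weight-literal (b , i) = s≤s (+-mono-≤ (weight-bit b)
      (≤-trans (≤-reflexive (weight-encodeℕ (toℕ i))) (<⇒≤ (Fin.toℕ<n i))))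

    weight-clause : ∀ {C} → length C ≤ k → weight (encodeClause C) ≤ k * (3 + N)
    weight-clause {C} C≤k = ≤-trans (weight-encodeList _ (All.map⁺ (All.universal weight-literal C)))
      (*-monoˡ-≤ (3 + N) (≤-trans (≤-reflexive (length-map encodeLiteral C)) C≤k))

  weight-literals : weight (encodeLits allLiterals) ≤ literalsWeight
  weight-literals = begin
    weight (encodeLits allLiterals)
      ≤⟨ weight-encodeList _ (All.map⁺ (All-literals (suc N) ≤-refl [])) ⟩
    length (map encodeLit allLiterals) * (3 + N)
      ≡⟨ cong (_* (3 + N)) (trans (length-map encodeLit allLiterals)
           (trans (length-literals (suc N) []) (+-identityʳ _))) ⟩
    literalsWeight ∎
    where
    open ≤-Reasoning
    weight-lit : ∀ b {i} → i ≤ N → weight (encodeLit (b , i)) ≤ 2 + N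
    weight-lit b {i} i≤N = s≤s (+-mono-≤ (weight-bit b) (≤-trans (≤-reflexive (weight-encodeℕ i)) i≤N))

    All-literals : ∀ M {acc} → M ≤ suc N → All (λ l → weight (encodeLit l) ≤ 2 + N) acc →
      All (λ l → weight (encodeLit l) ≤ 2 + N) (literals M acc)
    All-literals zero    M≤1+N ps = ps
    All-literals (suc M) (s≤s M≤N) ps =
      All-literals M (m≤n⇒m≤1+n M≤N) (weight-lit true M≤N ∷ weight-lit false M≤N ∷ ps)

-- The exponent is a huge numeral, hence abstract: unfolding (2 + N) ^ e is infeasible.
abstract
  overhead-poly : ∀ k → ∃ λ e → ∀ φ → Reduction.overhead (SAT-to-CIS k) φ ≤ (2 + size (SAT k) φ) ℕ.^ e
  overhead-poly k = proj₁ poly , λ φ → ≤-trans (bound φ) (proj₂ poly (size (SAT k) φ))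
    where
    S : ℕ → ℕ
    -- The sum of `formulaWeight` and `literalsWeight`, so that one `S` bounds both arguments of
    -- `systemᵉ`.
    S N = suc (N + suc (N + N) ℕ.^ k * suc (k * (3 + N))) + (suc N + suc N) * (3 + N)

    poly-S : PolyBounded S
    poly-S = (# 1 ⊕ (N ⊕ poly-^ (# 1 ⊕ (N ⊕ N)) k ⊗ (# 1 ⊕ # k ⊗ (# 3 ⊕ N)))) ⊕
             (# 1 ⊕ N ⊕ (# 1 ⊕ N)) ⊗ (# 3 ⊕ N)
      where
      open PolyBounds using (_⊕_; _⊗_; #)
      N : PolyBounded (λ n → n)
      N = poly-id

    poly : PolyBounded (λ N → reductionBound (S N) + suc (scratchEnd 1 reductionᵉ))
    poly = poly-+ (poly-∘ PolyBounds.reduction poly-S) (poly-const _)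

    bound : ∀ φ → Reduction.overhead (SAT-to-CIS k) φ
                ≤ reductionBound (S (size (SAT k) φ)) + suc (scratchEnd 1 reductionᵉ)
    bound φ = +-monoˡ-≤ _ (time-reduction (encodeFormula φ)
      (≤-trans (weight-encodeFormula φ) (m≤m+n (formulaWeight φ) (literalsWeight φ)))
      (subst (λ t → weight t ≤ S (Formula.N φ)) (sym (eval-literals (Formula.N φ)
          (encodeList (map (λ C → encodeList (map encodeLiteral C)) (Formula.clauses φ)))))
        (≤-trans (weight-literals φ) (m≤n+m (literalsWeight φ) (formulaWeight φ)))))

  SAT-to-CIS-size : ∀ {k} φ →
    size CIS (Reduction.instanceOf (SAT-to-CIS k) φ) ≡ suc (size (SAT k) φ) + suc (size (SAT k) φ)
  SAT-to-CIS-size = length-vertices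

  SAT-to-CIS-digraphs : ∀ {k} φ → let 𝒢 = Reduction.instanceOf (SAT-to-CIS k) φ in
    GraphSystem.m 𝒢 ≤ size CIS 𝒢 ℕ.^ suc k
  SAT-to-CIS-digraphs = digraphs-≤

-- Transfer of run times and the contradiction with SETH.

archimedean : ∀ x → 0ℚ ℚ.< x → ∃ λ q → 1ℚ ℚ.≤ x ℚ.* fromℕ (suc q)
archimedean x@(mkℚ (ℤ.+ zero) d _) 0<x = contradiction (ℚ.drop-*<* 0<x) (ℤ.<-irrefl refl)
archimedean x@(mkℚ (ℤ.-[1+ _ ]) d _) 0<x with ℚ.drop-*<* 0<x
... | ()
-- Multiplying `x` by its denominator `suc d` gives its numerator, a positive integer.
archimedean x@(mkℚ (ℤ.+[1+ n ]) d _) 0<x = d , ℚ.toℚᵘ-cancel-≤ (begin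
  toℚᵘ 1ℚ                           ≤⟨ *≤* (ℤ.+≤+ denominator≤) ⟩
  toℚᵘ x ℚᵘ.* mkℚᵘ (ℤ.+ suc d) 0    ≃⟨ ℚᵘ.*-cong {toℚᵘ x} ℚᵘ.≃-refl (toℚᵘ-fromℕ (suc d)) ⟨
  toℚᵘ x ℚᵘ.* toℚᵘ (fromℕ (suc d))  ≃⟨ ℚ.toℚᵘ-homo-* x (fromℕ (suc d)) ⟨
  toℚᵘ (x ℚ.* fromℕ (suc d))        ∎)
  where
  open ℚᵘ.≤-Reasoning
  denominator≤ : 1 * (suc d * 1) ≤ suc n * suc d * 1
  denominator≤ = subst₂ _≤_ (arith₁ (suc d)) (sym (*-identityʳ _)) (m≤m+n (suc d) (n * suc d))
    where
    arith₁ : ∀ a → a ≡ 1 * (a * 1)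
    arith₁ = solve-∀

-- Once `1 / (1 + q)` is at most `x`, the ratio `(2 + q) / (1 + q)` is at most `1 + x`; dividing
-- `polynomial-dominated` by `(1 + q) ^ n` gives the bound.
polynomial-O : ∀ e x → 0ℚ ℚ.< x → ∃ λ C → ∀ n → fromℕ ((2 + n) ℕ.^ e) ℚ.≤ fromℕ C ℚ.* (1ℚ ℚ.+ x) ^ n
polynomial-O e x 0<x with q , 1≤xq ← archimedean x 0<x with C , bound ← polynomial-dominated e q =
  C , λ n → ℚ.*-cancelʳ-≤-pos (fromℕ (suc q) ^ n) {{positive (qⁿ>0 n)}} (begin
    fromℕ ((2 + n) ℕ.^ e) ℚ.* fromℕ (suc q) ^ n
      ≡⟨ cong (fromℕ ((2 + n) ℕ.^ e) ℚ.*_) (fromℕ-^ (suc q) n) ⟨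
    fromℕ ((2 + n) ℕ.^ e) ℚ.* fromℕ (suc q ℕ.^ n)
      ≡⟨ fromℕ-* ((2 + n) ℕ.^ e) (suc q ℕ.^ n) ⟨
    fromℕ ((2 + n) ℕ.^ e * suc q ℕ.^ n)
      ≤⟨ fromℕ-mono-≤ (bound n) ⟩
    fromℕ (C * (2 + q) ℕ.^ n)
      ≡⟨ trans (fromℕ-* C ((2 + q) ℕ.^ n)) (cong (fromℕ C ℚ.*_) (fromℕ-^ (2 + q) n)) ⟩
    fromℕ C ℚ.* fromℕ (2 + q) ^ n
      ≤⟨ ℚ.*-monoˡ-≤-nonNeg (fromℕ C) {{nonNegative (0≤fromℕ C)}} (^-mono-≤ n (0≤fromℕ (2 + q)) ratio) ⟩
    fromℕ C ℚ.* ((1ℚ ℚ.+ x) ℚ.* fromℕ (suc q)) ^ n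
      ≡⟨ cong (fromℕ C ℚ.*_) (^ℚ-distrib-* (1ℚ ℚ.+ x) (fromℕ (suc q)) n) ⟩
    fromℕ C ℚ.* ((1ℚ ℚ.+ x) ^ n ℚ.* fromℕ (suc q) ^ n)
      ≡⟨ ℚ.*-assoc (fromℕ C) _ _ ⟨
    fromℕ C ℚ.* (1ℚ ℚ.+ x) ^ n ℚ.* fromℕ (suc q) ^ n ∎)
  where
  open ℚ.≤-Reasoning
  0≤fromℕ : ∀ m → 0ℚ ℚ.≤ fromℕ m
  0≤fromℕ m = fromℕ-mono-≤ {0} {m} z≤n

  ratio : fromℕ (2 + q) ℚ.≤ (1ℚ ℚ.+ x) ℚ.* fromℕ (suc q)
  ratio = begin
    fromℕ (1 + suc q)                      ≡⟨ fromℕ-+ 1 (suc q) ⟩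
    1ℚ ℚ.+ fromℕ (suc q)                   ≤⟨ ℚ.+-monoˡ-≤ (fromℕ (suc q)) 1≤xq ⟩
    x ℚ.* fromℕ (suc q) ℚ.+ fromℕ (suc q)  ≡⟨ solve 2 (λ x q → x :* q :+ q := (con 1ℚ :+ x) :* q)
                                                           refl x (fromℕ (suc q)) ⟩
    (1ℚ ℚ.+ x) ℚ.* fromℕ (suc q)           ∎
    where open +-*-Solver

  qⁿ>0 : ∀ n → 0ℚ ℚ.< fromℕ (suc q) ^ n
  qⁿ>0 n = ℚ.<-≤-trans (ℚ.positive⁻¹ 1ℚ) (begin
    fromℕ 1              ≤⟨ fromℕ-mono-≤ (m^n>0 (suc q) n) ⟩
    fromℕ (suc q ℕ.^ n)  ≡⟨ fromℕ-^ (suc q) n ⟩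
    fromℕ (suc q) ^ n    ∎)

p-[p-q]≡q : ∀ p q → p ℚ.- (p ℚ.- q) ≡ q
p-[p-q]≡q = solve 2 (λ p q → p :- (p :- q) := q) refl
  where open +-*-Solver

module _ (δ : ℚ) (0<δ : 0ℚ ℚ.< δ) (δ²<2 : δ ℚ.* δ ℚ.< 2ℚ) where

  -- ε lies strictly between max (1 , δ²) and 2.
  δ² ε : ℚ
  δ² = δ ℚ.* δ
  ε  = 1ℚ ℚ.+ ½ ℚ.* δ²

  0≤δ² : 0ℚ ℚ.≤ δ²
  0≤δ² = *ℚ-nonNeg (ℚ.<⇒≤ 0<δ) (ℚ.<⇒≤ 0<δ)

  0<½δ² : 0ℚ ℚ.< ½ ℚ.* δ²
  0<½δ² = subst (ℚ._< ½ ℚ.* δ²) (ℚ.*-zeroʳ ½) (ℚ.*-monoʳ-<-pos ½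
    (subst (ℚ._< δ²) (ℚ.*-zeroʳ δ) (ℚ.*-monoʳ-<-pos δ {{positive 0<δ}} 0<δ)))

  ½δ²<1 : ½ ℚ.* δ² ℚ.< 1ℚ
  ½δ²<1 = ℚ.*-monoʳ-<-pos ½ δ²<2

  δ²≤ε : δ² ℚ.≤ ε
  δ²≤ε = begin
    δ²                     ≡⟨ ℚ.*-identityˡ δ² ⟨
    (½ ℚ.+ ½) ℚ.* δ²       ≡⟨ ℚ.*-distribʳ-+ δ² ½ ½ ⟩
    ½ ℚ.* δ² ℚ.+ ½ ℚ.* δ²  ≤⟨ ℚ.+-monoˡ-≤ (½ ℚ.* δ²) (ℚ.<⇒≤ ½δ²<1) ⟩
    ε                      ∎
    where open ℚ.≤-Reasoning

  0<ε : 0ℚ ℚ.< ε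
  0<ε = ℚ.+-mono-< (ℚ.positive⁻¹ 1ℚ) 0<½δ²

  0<2-ε : 0ℚ ℚ.< 2ℚ ℚ.- ε
  0<2-ε = subst (ℚ._< 2ℚ ℚ.- ε) (ℚ.+-inverseʳ ε)
    (ℚ.+-monoˡ-< (ℚ.- ε) (ℚ.+-monoʳ-< 1ℚ ½δ²<1))

  -- Since `ε` exceeds 1 by half of `δ²`, `polynomial-O` bounds the overhead by a multiple of
  -- `ε ^ N`. On an instance of size `suc N + suc N`, `A` takes at most a constant times
  -- `δ² * δ² ^ N` steps, and `δ²≤ε`.
  reduce-RunTimeO : ∀ {P} (R : Reduction P CIS) e d → let R-instance = Reduction.instanceOf R in
    (∀ x → Reduction.overhead R x ≤ (2 + size P x) ℕ.^ e) →
    (∀ x → size CIS (R-instance x) ≡ suc (size P x) + suc (size P x)) →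
    (∀ x → GraphSystem.m (R-instance x) ≤ size CIS (R-instance x) ℕ.^ d) →
    ∀ A → RunTimeO A (CIS≤ d) δ → RunTimeO (Reduction.reduce R A) P ε
  reduce-RunTimeO {P} R e d overhead≤ size≡ m≤ A (C , run) =
    fromℕ D ℚ.+ C⁺ ℚ.* δ² , λ x →
      let T , halts , T≤ = run (instanceOf x , m≤ x)
      in overhead x + T , reduce-halts A x T halts , bound x T T≤
    where
    open Reduction R
    open ℚ.≤-Reasoning
    -- `RunTimeO` does not say that its constant is non-negative, which the monotonicity of
    -- multiplication requires.
    C⁺ = C ℚ.⊔ 0ℚ
    D  = proj₁ (polynomial-O e (½ ℚ.* δ²) 0<½δ²)

    main : ∀ x → C ℚ.* δ ^ size CIS (instanceOf x) ℚ.≤ C⁺ ℚ.* δ² ℚ.* ε ^ size P x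
    main x = let N = size P x in begin
      C ℚ.* δ ^ size CIS (instanceOf x)
        ≡⟨ cong (λ n → C ℚ.* δ ^ n) (size≡ x) ⟩
      C ℚ.* δ ^ (suc N + suc N)
        ≡⟨ cong (C ℚ.*_) (^-double δ (suc N)) ⟩
      C ℚ.* (δ² ℚ.* δ² ^ N)
        ≤⟨ *ℚ-mono-≤ (*ℚ-nonNeg 0≤δ² (^-nonNeg N 0≤δ²)) (ℚ.p≤q⊔p C 0ℚ) (ℚ.p≤p⊔q C 0ℚ)
             (ℚ.*-monoˡ-≤-nonNeg δ² {{nonNegative 0≤δ²}} (^-mono-≤ N 0≤δ² δ²≤ε)) ⟩
      C⁺ ℚ.* (δ² ℚ.* ε ^ N)
        ≡⟨ ℚ.*-assoc C⁺ δ² (ε ^ N) ⟨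
      C⁺ ℚ.* δ² ℚ.* ε ^ N ∎

    bound : ∀ x T → fromℕ T ℚ.≤ C ℚ.* δ ^ size CIS (instanceOf x) →
      fromℕ (overhead x + T) ℚ.≤ (fromℕ D ℚ.+ C⁺ ℚ.* δ²) ℚ.* ε ^ size P x
    bound x T T≤ = let N = size P x in begin
      fromℕ (overhead x + T)
        ≡⟨ fromℕ-+ (overhead x) T ⟩
      fromℕ (overhead x) ℚ.+ fromℕ T
        ≤⟨ ℚ.+-mono-≤ (ℚ.≤-trans (fromℕ-mono-≤ (overhead≤ x)) (proj₂ (polynomial-O e (½ ℚ.* δ²) 0<½δ²) N))
                      (ℚ.≤-trans T≤ (main x)) ⟩
      fromℕ D ℚ.* ε ^ N ℚ.+ C⁺ ℚ.* δ² ℚ.* ε ^ N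
        ≡⟨ ℚ.*-distribʳ-+ (ε ^ N) (fromℕ D) (C⁺ ℚ.* δ²) ⟨
      (fromℕ D ℚ.+ C⁺ ℚ.* δ²) ℚ.* ε ^ N ∎

  CIS-slow : SETH → ∀ A → Decides A CIS → ∃ λ d → ¬ RunTimeO A (CIS≤ d) δ
  -- The exponent is that of `digraphs-≤`. At tolerance `2ℚ - ε`, SETH yields a number above `ε`
  -- that bounds every base admissible for `K`-SAT from below; if `A` were fast, `ε` itself would be
  -- admissible.
  CIS-slow seth A dec = suc K , λ fast → ℚ.<-irrefl refl (begin-strict
    ε                  ≡⟨ p-[p-q]≡q 2ℚ ε ⟨
    2ℚ ℚ.- (2ℚ ℚ.- ε)  <⟨ proj₁ (proj₂ near) ⟩
    proj₁ near         ≤⟨ proj₂ (proj₂ near) ε (0<ε , reduce A , reduce-decides A dec ,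
                                 reduce-RunTimeO (SAT-to-CIS K) (proj₁ (overhead-poly K)) (suc K)
                                   (proj₂ (overhead-poly K)) SAT-to-CIS-size SAT-to-CIS-digraphs A fast) ⟩
    ε                  ∎)
    where
    open ℚ.≤-Reasoning
    K = proj₁ (seth (2ℚ ℚ.- ε) 0<2-ε)
    open Reduction (SAT-to-CIS K)

    near : lower (c K) (2ℚ ℚ.- (2ℚ ℚ.- ε))
    near = proj₁ (proj₂ (seth (2ℚ ℚ.- ε) 0<2-ε) K ≤-refl)

theorem2p4 :
  SETH → ∀ (A : Program) → Decides A CIS → RunTimeΩ A CIS √2 × NotBelow A √2
theorem2p4 seth A dec = CIS-RunTimeΩ-√2 A dec , λ where
  δ 0<δ (inj₁ δ<0)  → contradiction δ<0 (ℚ.<-asym 0<δ)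
  δ 0<δ (inj₂ δ²<2) → CIS-slow δ 0<δ δ²<2 seth A dec
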